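{- Let $G\in\mathcal{G}$ be a simple graph, let $\delta=\delta(G)$ and $\widetilde d=\widetilde d(G)$. Then for any two non-negative integers $s$ and $t$, \[ i_{s,t}(G)\le \begin{cases} \ell(G), & \text{if } \delta\le 2 \text{ and } s=t=0;\\ \widetilde d+1+\lceil \log_2 (s+t+1)\rceil, & \text{if } \delta\le 2 \text{ and } s+t\ge 1;\\ 1+\left\lceil\log_2\frac{s+t+1}{\delta-2}\right\rceil, & \text{if } 3\le\delta\le s+t+2;\\ 1, & \text{otherwise}. \end{cases} \]
   Context: Graphs are finite and loopless (parallel edges allowed in general); a simple graph has no parallel edges. $\delta(G)$ is the minimum degree. The line graph $L(G)$ is the simple graph with vertex set $E(G)$ in which two vertices are adjacent iff the corresponding edges of $G$ share an end vertex; $L^0(G)=G$ and $L^i(G)=L(L^{i-1}(G))$. Let $J_1$ (resp. $J_2$) be the graph obtained from $K_{1,3}$ by identifying two (resp. all three) of its degree-1 vertices. $\mathcal{G}$ is the family of connected graphs not isomorphic to a path, a cycle, $K_{1,3}$, $J_1$ or $J_2$. A path is divalent if each of its internal vertices has degree $2$ in $G$; a non-closed divalent path is proper if it is not both of length $2$ and contained in a $K_3$ of $G$. $\ell(G)$ is the maximum length of a proper divalent path of $G$. $\widetilde d(G)=\min\{i:\delta(L^i(G))\ge 3\}$ (this exists for $G\in\mathcal{G}$). For non-negative integers $s,t$, a graph $H$ is $(s,t)$-supereulerian if for any disjoint $X,Y\subset E(H)$ with $|X|\le s$ and $|Y|\le t$, the graph obtained from $H$ by deleting the edges of $Y$ contains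 a spanning closed trail that traverses all edges of $X$. The $(s,t)$-supereulerian index $i_{s,t}(G)$ is the smallest integer $i\ge 0$ such that $L^i(G)$ is $(s,t)$-supereulerian (and $\infty$ if no such $i$ exists). -}

module Defs where

open import Data.Nat using (ℕ; zero; suc; _+_; _*_; _∸_; _^_; _≤_; _<_; _⊓_; _≡ᵇ_)
open import Data.Bool using (Bool; true; false; _∧_; _∨_; not; if_then_else_)
open import Data.Fin using (Fin; zero; suc; toℕ; inject₁; fromℕ; _≟_; _<?_)
open import Data.Fin.Subset using (Subset; _∈_; _∉_; ∣_∣)
open import Data.List using (List; []; _∷_; length; concatMap; foldr; map; lookup; allFin)
open import Data.Nat.ListAction using (sum)
open import Data.List.Relation.Unary.All using (All)
open import Data.List.Relation.Unary.Any using (Any)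
open import Data.List.Relation.Unary.Unique.Propositional using (Unique)
open import Data.Product using (Σ; ∃; _×_; _,_; proj₁; proj₂)
open import Data.Sum using (_⊎_)
open import Relation.Nullary using (¬_)
open import Relation.Nullary.Decidable using (⌊_⌋)
open import Relation.Binary.PropositionalEquality using (_≡_)
open import Function.Bundles using (_↔_; Inverse)
open import Function.Definitions using (Injective)

-- Finite simple graphs.  Vertex set Fin n.  E is an arbitrary Boolean
-- "edge indicator"; the (simple, loopless, symmetric) adjacency is
-- adjB i j = (i ≠ j) ∧ (E i j ∨ E j i).  Every finite simple graph is
-- representable this way, and every value is a simple graph.

record Graph : Set where
  field
    n : ℕ
    E : Fin n → Fin n → Bool

open Graph public

adjB : (G : Graph) → Fin (n G) → Fin (n G) → Bool
adjB G i j = not ⌊ i ≟ j ⌋ ∧ (E G i j ∨ E G j i)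

Adj : (G : Graph) → Fin (n G) → Fin (n G) → Set
Adj G i j = adjB G i j ≡ true

deg : (G : Graph) → Fin (n G) → ℕ
deg G v = sum (map (λ j → if adjB G v j then 1 else 0) (allFin (n G)))

-- minimum degree δ(G) (0 for the empty graph, which never occurs below)
minOver : (k : ℕ) → (Fin k → ℕ) → ℕ
minOver zero    f = 0
minOver (suc k) f = foldr (λ j acc → f j ⊓ acc) (f zero) (allFin (suc k))

minDeg : Graph → ℕ
minDeg G = minOver (n G) (deg G)

edgeList : (G : Graph) → List (Fin (n G) × Fin (n G))
edgeList G =
  concatMap (λ i → concatMap (λ j →
      if ⌊ i <? j ⌋ ∧ adjB G i j then (i , j) ∷ [] else [])
    (allFin (n G))) (allFin (n G))

m : Graph → ℕ
m G = length (edgeList G)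

ends : (G : Graph) → Fin (m G) → Fin (n G) × Fin (n G)
ends G e = lookup (edgeList G) e

Incident : (G : Graph) → Fin (n G) → Fin (m G) → Set
Incident G v e = (proj₁ (ends G e) ≡ v) ⊎ (proj₂ (ends G e) ≡ v)

Joins : (G : Graph) → Fin (m G) → Fin (n G) → Fin (n G) → Set
Joins G e u v = (ends G e ≡ (u , v)) ⊎ (ends G e ≡ (v , u))

eqB : {k : ℕ} → Fin k → Fin k → Bool
eqB a b = ⌊ a ≟ b ⌋

shareEnd : {k : ℕ} → Fin k × Fin k → Fin k × Fin k → Bool
shareEnd (a , b) (c , d) = eqB a c ∨ eqB a d ∨ eqB b c ∨ eqB b d

L : Graph → Graph
L G = record { n = m G ; E = λ e f → shareEnd (ends G e) (ends G f) }

L^ : ℕ → Graph → Graph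
L^ zero    G = G
L^ (suc i) G = L (L^ i G)

data Reach (G : Graph) : Fin (n G) → Fin (n G) → Set where
  here : ∀ {u} → Reach G u u
  step : ∀ {u v w} → Adj G u v → Reach G v w → Reach G u w

Connected : Graph → Set
Connected G = (0 < n G) × (∀ u v → Reach G u v)

Iso : Graph → Graph → Set
Iso G H = Σ (Fin (n G) ↔ Fin (n H)) λ f →
  ∀ u v → adjB G u v ≡ adjB H (Inverse.to f u) (Inverse.to f v)

pathGraph : ℕ → Graph
pathGraph k = record { n = k ; E = λ i j → toℕ j ≡ᵇ suc (toℕ i) }

cycleGraph : ℕ → Graph
cycleGraph k = record { n = k ; E = λ i j →
  (toℕ j ≡ᵇ suc (toℕ i)) ∨ ((toℕ i ≡ᵇ 0) ∧ (toℕ j ≡ᵇ (k ∸ 1))) }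

K13 : Graph
K13 = record { n = 4 ; E = λ i j → toℕ i ≡ᵇ 0 }

IsPath : Graph → Set
IsPath G = ∃ λ k → Iso G (pathGraph k)

IsCycle : Graph → Set
IsCycle G = ∃ λ k → (3 ≤ k) × Iso G (cycleGraph k)

-- G ∈ 𝒢 for a simple graph G (J₁ and J₂ have parallel edges, so a simple
-- graph is never isomorphic to them).
InFamily : Graph → Set
InFamily G = Connected G × ¬ IsPath G × ¬ IsCycle G × ¬ Iso G K13

record DivalentPath (G : Graph) (k : ℕ) : Set where
  field
    vtx      : Fin (suc k) → Fin (n G)
    distinct : Injective _≡_ _≡_ vtx
    adjacent : ∀ (i : Fin k) → Adj G (vtx (inject₁ i)) (vtx (suc i))
    internal : ∀ (i : Fin (suc k)) → 0 < toℕ i → toℕ i < k → deg G (vtx i) ≡ 2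

-- proper: not (of length 2 and contained in a K₃)
Proper : {G : Graph} {k : ℕ} → DivalentPath G k → Set
Proper {G} {k} P =
  ¬ ((k ≡ 2) × Adj G (DivalentPath.vtx P zero) (DivalentPath.vtx P (fromℕ k)))

ProperDivalentPath : Graph → ℕ → Set
ProperDivalentPath G k = Σ (DivalentPath G k) Proper

IsEll : Graph → ℕ → Set
IsEll G l = ProperDivalentPath G l × (∀ k → ProperDivalentPath G k → k ≤ l)

IsDtilde : Graph → ℕ → Set
IsDtilde G d = (3 ≤ minDeg (L^ d G)) × (∀ i → i < d → minDeg (L^ i G) < 3)

-- ⌈log₂ (a / b)⌉ for positive a, b with a/b > 1/2:
-- the least k ∈ ℕ with a/b ≤ 2^k, i.e. a ≤ b * 2^k.

IsCeilLog2Frac : ℕ → ℕ → ℕ → Set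
IsCeilLog2Frac a b k = (a ≤ b * 2 ^ k) × (∀ j → a ≤ b * 2 ^ j → k ≤ j)

data Walk (H : Graph) : Fin (n H) → Fin (n H) → List (Fin (m H)) → Set where
  nil  : ∀ v → Walk H v v []
  cons : ∀ {u v w es} (e : Fin (m H)) → Joins H e u v → Walk H v w es →
         Walk H u w (e ∷ es)

SpanningClosedTrail : (H : Graph) → (X Y : Subset (m H)) → Set
SpanningClosedTrail H X Y =
  Σ (Fin (n H)) λ u → Σ (List (Fin (m H))) λ es →
    Walk H u u es
  × Unique es
  × All (λ e → e ∉ Y) es
  × (∀ e → e ∈ X → Any (e ≡_) es)
  × (∀ v → (v ≡ u) ⊎ Any (Incident H v) es)

Supereulerian : ℕ → ℕ → Graph → Set
Supereulerian s t H =
  ∀ (X Y : Subset (m H)) → (∀ e → e ∈ X → e ∉ Y) →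
    ∣ X ∣ ≤ s → ∣ Y ∣ ≤ t → SpanningClosedTrail H X Y

IndexAtMost : ℕ → ℕ → Graph → ℕ → Set
IndexAtMost s t G B = ∃ λ i → (i ≤ B) × Supereulerian s t (L^ i G)

{-# OPTIONS --safe #-}

-- A line graph L(G) is the edge-disjoint union of the cliques K_v formed by the edges of G at a vertex v.
-- A clique on k vertices stays collapsible in the sense of Catlin after the loss of k - 3 edges, and collapsible
-- pieces sharing a vertex merge. Hence if δ(G) ≥ s + t + 3, then L(G) - X - Y has a connected spanning subgraph whose
-- odd vertices are those of X; adding X yields an eulerian subgraph. As δ(L(G)) - 2 ≥ 2 (δ(G) - 2), iterating L reduces
-- all cases but the first to this one. In the first case, iterating L shortens every divalent path until the
-- vertices of degree at least 3 induce a connected subgraph and every vertex of degree 1 is adjacent to one of them; in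
-- the next line graph, the cliques at these vertices then merge, and all remaining edges are put into the trail.

module Submission where

open import Defs
open import Data.Bool using (Bool; true; false; _∧_; _∨_; not; if_then_else_; _xor_)
import Data.Bool as Bool
open import Data.Bool.Properties using (∨-comm; xor-assoc; xor-comm; xor-same; xor-identityʳ; ⇔→≡; T-≡)
open import Data.Empty using (⊥; ⊥-elim)
open import Data.Fin using (Fin; zero; suc; toℕ; inject₁; fromℕ; _≟_; _<?_)
import Data.Fin as Fin
import Data.Fin.Properties as Finₚ
import Data.Fin.Subset as Subset
open import Data.List using (List; []; _∷_; _++_; length; concatMap; foldr; map; lookup; allFin; filter)
open import Data.List.Properties
  using (length-map; length-++; length-tabulate; length-filter; filter-none; ++-identityʳ; ++-assoc)
open import Data.List.Membership.Propositional using (_∈_; _∉_; find; lose)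
open import Data.List.Membership.Propositional.Properties
  using (∈-∃++; ∈-filter⁺; ∈-filter⁻; ∈-allFin; ∈-lookup; ∈-concatMap⁺; ∈-concatMap⁻; ∈-map⁺; ∈-map⁻; ∈-++⁺ˡ; ∈-++⁺ʳ; ∈-++⁻)
open import Data.List.Relation.Unary.All as All using (All; []; _∷_)
import Data.List.Relation.Unary.All.Properties as Allₚ
open import Data.List.Relation.Unary.Any as Any using (Any; here; there)
import Data.List.Relation.Unary.Any.Properties as Anyₚ
open import Data.List.Relation.Unary.AllPairs as AllPairs using ([]; _∷_)
import Data.List.Relation.Unary.AllPairs.Properties as AllPairsₚ
open import Data.List.Relation.Unary.Unique.Propositional using (Unique)
import Data.List.Relation.Unary.Unique.Propositional.Properties as Uniqueₚ
open import Data.List.Relation.Binary.Permutation.Propositional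
  using (_↭_; ↭-refl; ↭-sym; ↭-trans; prep; swap; ↭⇒↭ₛ)
open import Data.List.Relation.Binary.Permutation.Propositional.Properties
  using (∈-resp-↭; ↭-length; shift; shifts; ++-comm; ++⁺)
open import Data.List.Relation.Binary.Permutation.Setoid.Properties using (Unique-resp-↭)
open import Data.Nat as ℕ using (ℕ; zero; suc; _+_; _*_; _∸_; _^_; _≤_; _<_; z≤n; s≤s; _⊓_)
open import Data.Nat.Induction using (<-rec)
open import Data.Nat.ListAction using (sum)
open import Data.Nat.Logarithm using (⌈log₂_⌉; ⌈log₂⌉-mono-≤; ⌈log₂⌈n/2⌉⌉≡⌈log₂n⌉∸1)
import Data.Nat.Properties as ℕₚ
open import Data.Nat.Solver using (module +-*-Solver)
open import Data.Product using (∃; _×_; _,_; proj₁; proj₂)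
open import Data.Sum using (_⊎_; inj₁; inj₂; [_,_]′)
open import Data.Unit using (⊤; tt)
import Data.Vec as Vec
open import Function using (_∘_; case_of_; id)
open import Function.Bundles using (Equivalence; mk↔ₛ′; mk⇔)
open import Relation.Binary using (tri<; tri≈; tri>)
open import Relation.Binary.PropositionalEquality
  using (_≡_; _≢_; refl; sym; trans; cong; cong₂; subst; subst₂; setoid; ≢-sym)
open import Relation.Nullary using (¬_; Dec; yes; no)
open import Relation.Nullary.Decidable using (⌊_⌋; ¬?; _×-dec_; _⊎-dec_)

-- The constant 3 in `s + t + 3` is the size of an intact triangle, the base of the clique argument.
-- Every forbidden edge of a clique costs one further vertex: an end of it other than the root is
-- set aside, which removes the edge from the remaining clique, and that vertex can still be
-- attached by one or two permitted edges, according to its parity. Edges of X are forbidden along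
-- with those of Y while the core is built and are added afterwards, so s and t draw on the same
-- budget. In the first case, ℓ(G) bounds proper paths only. It is used on G itself, to bound hops
-- between vertices of degree at least 3; from then on hops are mere walks, whose length bound drops
-- by one with each L. The bound 1 is reached after ℓ(G) - 1 rounds, and one more round merges the
-- cliques. Membership in 𝒢 provides an edge of degree sum at least 5 with an end of degree at least
-- 3. The line graph inherits such an edge, which keeps the core nonempty; paths, cycles and the
-- claw have none.

-- Lists without repetition

∈⇒↭∷ : {A : Set} {x : A} {xs : List A} → x ∈ xs → ∃ λ ys → xs ↭ x ∷ ys
∈⇒↭∷ {x = x} p with ∈-∃++ p
... | ys , zs , refl = ys ++ zs , shift x ys zs

unique-resp-↭ : {A : Set} {xs ys : List A} → xs ↭ ys → Unique xs → Unique ys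
unique-resp-↭ {A} p = Unique-resp-↭ (setoid A) (↭⇒↭ₛ p)

unique-⊆-length : {A : Set} {xs ys : List A} → Unique xs → (∀ {x} → x ∈ xs → x ∈ ys) → length xs ≤ length ys
unique-⊆-length [] _ = z≤n
unique-⊆-length {A} {x ∷ xs} {ys} (x∉ ∷ u) sub with ∈⇒↭∷ (sub (here refl))
... | ys′ , p = subst (suc (length xs) ≤_) (sym (↭-length p)) (s≤s (unique-⊆-length u sub′))
  where
  sub′ : ∀ {y} → y ∈ xs → y ∈ ys′
  sub′ y∈ with ∈-resp-↭ p (sub (there y∈))
  ... | here refl = ⊥-elim (All.lookup x∉ y∈ refl)
  ... | there q = q

lookup-injective : {A : Set} {xs : List A} → Unique xs → ∀ {i j} → lookup xs i ≡ lookup xs j → i ≡ j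
lookup-injective (_ ∷ _) {zero} {zero} _ = refl
lookup-injective (x∉ ∷ _) {zero} {suc j} e = ⊥-elim (All.lookup x∉ (∈-lookup j) e)
lookup-injective (x∉ ∷ _) {suc i} {zero} e = ⊥-elim (All.lookup x∉ (∈-lookup i) (sym e))
lookup-injective (_ ∷ u) {suc i} {suc j} e = cong suc (lookup-injective u e)

sum-indicator : {A : Set} (p : A → Bool) (xs : List A) →
  sum (map (λ j → if p j then 1 else 0) xs) ≡ length (filter (λ j → p j Bool.≟ true) xs)
sum-indicator p [] = refl
sum-indicator p (x ∷ xs) with p x
... | true  = cong suc (sum-indicator p xs)
... | false = sum-indicator p xs

-- Neighbourhoods, degrees and reachability

module _ (G : Graph) where

  V : Set
  V = Fin (n G)

  nbrs : V → List V
  nbrs v = filter (λ j → adjB G v j Bool.≟ true) (allFin (n G))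

  deg≡length-nbrs : ∀ v → deg G v ≡ length (nbrs v)
  deg≡length-nbrs v = sum-indicator (adjB G v) (allFin (n G))

  nbrs-unique : ∀ v → Unique (nbrs v)
  nbrs-unique v = Uniqueₚ.filter⁺ _ (Uniqueₚ.allFin⁺ (n G))

  ∈-nbrs⁺ : ∀ {v w} → Adj G v w → w ∈ nbrs v
  ∈-nbrs⁺ a = ∈-filter⁺ _ (∈-allFin _) a

  ∈-nbrs⁻ : ∀ {v w} → w ∈ nbrs v → Adj G v w
  ∈-nbrs⁻ {v} p = proj₂ (∈-filter⁻ (λ j → adjB G v j Bool.≟ true) {xs = allFin (n G)} p)

  length≤deg : ∀ {v xs} → Unique xs → (∀ {w} → w ∈ xs → Adj G v w) → length xs ≤ deg G v
  length≤deg {v} u a = subst (_ ≤_) (sym (deg≡length-nbrs v)) (unique-⊆-length u (∈-nbrs⁺ ∘ a))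

  deg≤length : ∀ {v xs} → (∀ {w} → Adj G v w → w ∈ xs) → deg G v ≤ length xs
  deg≤length {v} a = subst (_≤ _) (sym (deg≡length-nbrs v)) (unique-⊆-length (nbrs-unique v) (a ∘ ∈-nbrs⁻))

  adj-irrefl : ∀ {v} → ¬ Adj G v v
  adj-irrefl {v} a with v ≟ v
  adj-irrefl {v} () | yes _
  ... | no ¬p = ¬p refl

  adj⇒≢ : ∀ {u v} → Adj G u v → u ≢ v
  adj⇒≢ a refl = adj-irrefl a

  adjB-sym : ∀ u v → adjB G u v ≡ adjB G v u
  adjB-sym u v with u ≟ v | v ≟ u
  ... | yes _ | yes _ = refl
  ... | yes p | no ¬p = ⊥-elim (¬p (sym p))
  ... | no ¬p | yes p = ⊥-elim (¬p (sym p))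
  ... | no _  | no _  = ∨-comm (E G u v) (E G v u)

  adj-sym : ∀ {u v} → Adj G u v → Adj G v u
  adj-sym {u} {v} a = trans (adjB-sym v u) a

  adj? : ∀ u v → Dec (Adj G u v)
  adj? u v = adjB G u v Bool.≟ true

  reach-trans : ∀ {u v w} → Reach G u v → Reach G v w → Reach G u w
  reach-trans here q = q
  reach-trans (step a p) q = step a (reach-trans p q)

  reach-sym : ∀ {u v} → Reach G u v → Reach G v u
  reach-sym here = here
  reach-sym (step a p) = reach-trans (reach-sym p) (step (adj-sym a) here)

-- Minimum degree

foldr-⊓-≤ : {A : Set} (f : A → ℕ) (z : ℕ) (xs : List A) {x : A} → x ∈ xs → foldr (λ j acc → f j ⊓ acc) z xs ≤ f x
foldr-⊓-≤ f z (x ∷ xs) (here refl) = ℕₚ.m⊓n≤m _ _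
foldr-⊓-≤ f z (x ∷ xs) (there p) = ℕₚ.≤-trans (ℕₚ.m⊓n≤n _ _) (foldr-⊓-≤ f z xs p)

≤-foldr-⊓ : {A : Set} (f : A → ℕ) {c z : ℕ} (xs : List A) → c ≤ z → (∀ x → c ≤ f x) → c ≤ foldr (λ j acc → f j ⊓ acc) z xs
≤-foldr-⊓ f [] cz h = cz
≤-foldr-⊓ f (x ∷ xs) cz h = ℕₚ.⊓-glb (h x) (≤-foldr-⊓ f xs cz h)

minOver≤ : ∀ k (f : Fin k → ℕ) v → minOver k f ≤ f v
minOver≤ (suc k) f v = foldr-⊓-≤ f (f zero) (allFin (suc k)) (∈-allFin v)

≤minOver : ∀ k (f : Fin k → ℕ) {c} → 0 < k → (∀ v → c ≤ f v) → c ≤ minOver k f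
≤minOver (suc k) f _ h = ≤-foldr-⊓ f (allFin (suc k)) (h zero) h

minDeg≤deg : ∀ G v → minDeg G ≤ deg G v
minDeg≤deg G = minOver≤ (n G) (deg G)

≤minDeg : ∀ G {c} → 0 < n G → (∀ v → c ≤ deg G v) → c ≤ minDeg G
≤minDeg G = ≤minOver (n G) (deg G)

0<minDeg⇒0<n : ∀ G → 0 < minDeg G → 0 < n G
0<minDeg⇒0<n G p with n G | deg G
0<minDeg⇒0<n G () | zero | _
... | suc k | _ = s≤s z≤n

-- Edges

module _ (G : Graph) where

  private
    cell : V G → V G → List (V G × V G)
    cell i j = if ⌊ i <? j ⌋ ∧ adjB G i j then (i , j) ∷ [] else []

    row : V G → List (V G × V G)
    row i = concatMap (cell i) (allFin (n G))

    ∈-cell⁺ : ∀ {i j} → i Fin.< j → Adj G i j → (i , j) ∈ cell i j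
    ∈-cell⁺ {i} {j} i<j a with i <? j
    ... | no ¬p = ⊥-elim (¬p i<j)
    ... | yes _ rewrite a = here refl

    ∈-cell⁻ : ∀ {i j p} → p ∈ cell i j → p ≡ (i , j) × i Fin.< j × Adj G i j
    ∈-cell⁻ {i} {j} q with i <? j
    ∈-cell⁻ () | no _
    ... | yes i<j with adjB G i j
    ∈-cell⁻ (here refl) | yes i<j | true = refl , i<j , refl
    ∈-cell⁻ () | yes i<j | false

    cell-unique : ∀ i j → Unique (cell i j)
    cell-unique i j with ⌊ i <? j ⌋ ∧ adjB G i j
    ... | true = [] ∷ []
    ... | false = []

    ∈-row⁻ : ∀ {i p} → p ∈ row i → ∃ λ j → p ≡ (i , j) × i Fin.< j × Adj G i j
    ∈-row⁻ {i} q with Any.satisfied (∈-concatMap⁻ (cell i) {xs = allFin (n G)} q)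
    ... | j , r = j , ∈-cell⁻ r

    -- Blocks of different indices are disjoint because `g` recovers the index from any element of a
    -- block.
    concatMap-unique : {A B : Set} (f : A → List B) (g : B → A) →
      (∀ x → Unique (f x)) → (∀ x {y} → y ∈ f x → g y ≡ x) →
      ∀ {xs} → Unique xs → Unique (concatMap f xs)
    concatMap-unique f g uf gf u = Uniqueₚ.concat⁺
      (Allₚ.map⁺ (All.universal uf _))
      (AllPairsₚ.map⁺ (AllPairs.map (λ x≢y {_} (p , q) → x≢y (trans (sym (gf _ p)) (gf _ q))) u))

  edgeList-unique : Unique (edgeList G)
  edgeList-unique = concatMap-unique row proj₁
    (λ i → concatMap-unique (cell i) proj₂ (cell-unique i)
             (λ j q → cong proj₂ (proj₁ (∈-cell⁻ q))) (Uniqueₚ.allFin⁺ _))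
    (λ i q → cong proj₁ (proj₁ (proj₂ (∈-row⁻ q)))) (Uniqueₚ.allFin⁺ _)

  ∈-edgeList⁺ : ∀ {i j} → i Fin.< j → Adj G i j → (i , j) ∈ edgeList G
  ∈-edgeList⁺ {i} {j} i<j a =
    ∈-concatMap⁺ row (Any.map (λ { refl → ∈-concatMap⁺ (cell i) (Any.map (λ { refl → ∈-cell⁺ i<j a }) (∈-allFin j)) }) (∈-allFin i))

  ∈-edgeList⁻ : ∀ {p} → p ∈ edgeList G → proj₁ p Fin.< proj₂ p × Adj G (proj₁ p) (proj₂ p)
  ∈-edgeList⁻ q with Any.satisfied (∈-concatMap⁻ row {xs = allFin (n G)} q)
  ... | i , r with ∈-row⁻ r
  ... | j , refl , s = s

  Ed : Set
  Ed = Fin (m G)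

  ends-< : ∀ e → proj₁ (ends G e) Fin.< proj₂ (ends G e)
  ends-< e = proj₁ (∈-edgeList⁻ (∈-lookup e))

  ends-adj : ∀ e → Adj G (proj₁ (ends G e)) (proj₂ (ends G e))
  ends-adj e = proj₂ (∈-edgeList⁻ (∈-lookup e))

  joins⇒adj : ∀ {e u v} → Joins G e u v → Adj G u v
  joins⇒adj {e} (inj₁ p) = subst (λ q → Adj G (proj₁ q) (proj₂ q)) p (ends-adj e)
  joins⇒adj {e} (inj₂ p) = adj-sym G (subst (λ q → Adj G (proj₁ q) (proj₂ q)) p (ends-adj e))

  joins-sym : ∀ {e u v} → Joins G e u v → Joins G e v u
  joins-sym (inj₁ p) = inj₂ p
  joins-sym (inj₂ p) = inj₁ p

  edge : ∀ {u v} → Adj G u v → ∃ λ e → Joins G e u v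
  edge {u} {v} a with Finₚ.<-cmp u v
  ... | tri< u<v _ _ = let q = ∈-edgeList⁺ u<v a in Any.index q , inj₁ (sym (Anyₚ.lookup-index q))
  ... | tri≈ _ u≡v _ = ⊥-elim (adj⇒≢ G a u≡v)
  ... | tri> _ _ v<u = let q = ∈-edgeList⁺ v<u (adj-sym G a) in Any.index q , inj₂ (sym (Anyₚ.lookup-index q))

  ends-injective : ∀ {e f} → ends G e ≡ ends G f → e ≡ f
  ends-injective = lookup-injective edgeList-unique

  joins-unique : ∀ {e f u v} → Joins G e u v → Joins G f u v → e ≡ f
  joins-unique (inj₁ p) (inj₁ q) = ends-injective (trans p (sym q))
  joins-unique (inj₂ p) (inj₂ q) = ends-injective (trans p (sym q))
  -- Edges are listed with the smaller end first, so opposite orientations would give both `u < v`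
  -- and `v < u`.
  joins-unique {e} {f} (inj₁ p) (inj₂ q) = ⊥-elim (Finₚ.<-asym
    (subst (λ z → proj₁ z Fin.< proj₂ z) p (ends-< e)) (subst (λ z → proj₁ z Fin.< proj₂ z) q (ends-< f)))
  joins-unique {e} {f} (inj₂ p) (inj₁ q) = ⊥-elim (Finₚ.<-asym
    (subst (λ z → proj₁ z Fin.< proj₂ z) p (ends-< e)) (subst (λ z → proj₁ z Fin.< proj₂ z) q (ends-< f)))

  incident⇒joins : ∀ {v e} → Incident G v e → ∃ λ w → Joins G e v w
  incident⇒joins {v} {e} (inj₁ refl) = proj₂ (ends G e) , inj₁ refl
  incident⇒joins {v} {e} (inj₂ refl) = proj₁ (ends G e) , inj₂ refl

  joins⇒incidentˡ : ∀ {e u v} → Joins G e u v → Incident G u e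
  joins⇒incidentˡ (inj₁ p) = inj₁ (cong proj₁ p)
  joins⇒incidentˡ (inj₂ p) = inj₂ (cong proj₂ p)

  joins⇒incidentʳ : ∀ {e u v} → Joins G e u v → Incident G v e
  joins⇒incidentʳ j = joins⇒incidentˡ (joins-sym j)

  joins-incident : ∀ {e u v w} → Joins G e u v → Incident G w e → (u ≡ w) ⊎ (v ≡ w)
  joins-incident (inj₁ p) (inj₁ q) = inj₁ (trans (sym (cong proj₁ p)) q)
  joins-incident (inj₁ p) (inj₂ q) = inj₂ (trans (sym (cong proj₂ p)) q)
  joins-incident (inj₂ p) (inj₁ q) = inj₂ (trans (sym (cong proj₁ p)) q)
  joins-incident (inj₂ p) (inj₂ q) = inj₁ (trans (sym (cong proj₂ p)) q)

  ends-joins : ∀ e → Joins G e (proj₁ (ends G e)) (proj₂ (ends G e))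
  ends-joins e = inj₁ refl

  other-end-unique : ∀ {e u v w} → Joins G e u v → Joins G e u w → v ≡ w
  other-end-unique j k with joins-incident j (joins⇒incidentʳ k)
  ... | inj₁ u≡w = ⊥-elim (adj⇒≢ G (joins⇒adj k) u≡w)
  ... | inj₂ p = p

  incident? : ∀ v e → Dec (Incident G v e)
  incident? v e = (proj₁ (ends G e) ≟ v) ⊎-dec (proj₂ (ends G e) ≟ v)

-- Parity of edge lists and Euler's theorem

xor-cancelˡ : ∀ x y → x xor (x xor y) ≡ y
xor-cancelˡ true true = refl
xor-cancelˡ true false = refl
xor-cancelˡ false y = refl

eqB-refl : ∀ {k} (a : Fin k) → eqB a a ≡ true
eqB-refl a with a ≟ a
... | yes _ = refl
... | no ¬p = ⊥-elim (¬p refl)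

eqB-≢ : ∀ {k} {a b : Fin k} → a ≢ b → eqB a b ≡ false
eqB-≢ {a = a} {b} a≢b with a ≟ b
... | yes p = ⊥-elim (a≢b p)
... | no _ = refl

module _ (H : Graph) where

  inc : Ed H → V H → Bool
  inc e v = eqB (proj₁ (ends H e)) v xor eqB (proj₂ (ends H e)) v

  par : List (Ed H) → V H → Bool
  par [] v = false
  par (e ∷ F) v = inc e v xor par F v

  inc-joins : ∀ {e u w} → Joins H e u w → ∀ v → inc e v ≡ eqB u v xor eqB w v
  inc-joins (inj₁ p) v = cong (λ q → eqB (proj₁ q) v xor eqB (proj₂ q) v) p
  inc-joins {u = u} {w} (inj₂ p) v =
    trans (cong (λ q → eqB (proj₁ q) v xor eqB (proj₂ q) v) p) (xor-comm (eqB w v) (eqB u v))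

  inc-other : ∀ {e u w} → Joins H e u w → ∀ {v} → u ≢ v → inc e v ≡ eqB w v
  inc-other j {v} u≢v = trans (inc-joins j v) (cong (_xor _) (eqB-≢ u≢v))

  inc-end : ∀ {e u w} → Joins H e u w → inc e u ≡ true
  inc-end {u = u} j = trans (inc-joins j u)
    (cong₂ _xor_ (eqB-refl u) (eqB-≢ (≢-sym (adj⇒≢ H (joins⇒adj H j)))))

  ¬incident⇒inc : ∀ {e v} → ¬ Incident H v e → inc e v ≡ false
  ¬incident⇒inc ¬i = cong₂ _xor_ (eqB-≢ (¬i ∘ inj₁)) (eqB-≢ (¬i ∘ inj₂))

  par-++ : ∀ F F′ v → par (F ++ F′) v ≡ par F v xor par F′ v
  par-++ [] F′ v = refl
  par-++ (e ∷ F) F′ v = trans (cong (inc e v xor_) (par-++ F F′ v)) (sym (xor-assoc (inc e v) _ _))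

  par-↭ : ∀ {F F′} → F ↭ F′ → ∀ v → par F v ≡ par F′ v
  par-↭ _↭_.refl v = refl
  par-↭ (prep e p) v = cong (inc e v xor_) (par-↭ p v)
  par-↭ (swap e f p) v = trans (cong (λ z → inc e v xor (inc f v xor z)) (par-↭ p v))
    (trans (sym (xor-assoc (inc e v) _ _)) (trans (cong (_xor _) (xor-comm (inc e v) (inc f v))) (xor-assoc (inc f v) _ _)))
  par-↭ (_↭_.trans p q) v = trans (par-↭ p v) (par-↭ q v)

  par-∉ : ∀ F v → (∀ {e} → e ∈ F → ¬ Incident H v e) → par F v ≡ false
  par-∉ [] v h = refl
  par-∉ (e ∷ F) v h = cong₂ _xor_ (¬incident⇒inc (h (here refl))) (par-∉ F v (h ∘ there))

  odd⇒∃ : ∀ F v → par F v ≡ true → ∃ λ e → e ∈ F × Incident H v e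
  odd⇒∃ (e ∷ F) v p with incident? H v e
  ... | yes i = e , here refl , i
  ... | no ¬i with odd⇒∃ F v (trans (sym (cong (_xor par F v) (¬incident⇒inc ¬i))) p)
  ... | f , q , i = f , there q , i

  odd⇒extract : ∀ F v → par F v ≡ true → ∃ λ e → ∃ λ F′ → ∃ λ w → F ↭ e ∷ F′ × Joins H e v w
  odd⇒extract F v p with odd⇒∃ F v p
  ... | e , e∈F , i with ∈⇒↭∷ e∈F | incident⇒joins H i
  ... | F′ , q | w , j = e , F′ , w , q , j

  par-extract : ∀ {F F′ e a w} → F ↭ e ∷ F′ → Joins H e a w → ∀ v → par F′ v ≡ (eqB a v xor eqB w v) xor par F v
  par-extract {F} {F′} {e} p j v = trans (sym (xor-cancelˡ (inc e v) _))
    (cong₂ _xor_ (inc-joins j v) (sym (par-↭ p v)))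

  -- While `a` differs from `b` it is odd, so some edge of `F` leaves it; deleting that edge moves
  -- the odd vertex to its other end. The greedy walk stops on reaching `b`, and `R` is what it
  -- leaves over. `k` is fuel.
  trail : ∀ k F a b → length F ≤ k → (∀ v → par F v ≡ eqB a v xor eqB b v) →
          ∃ λ es → ∃ λ R → Walk H a b es × F ↭ es ++ R
  trail k F a b l h with a ≟ b
  ... | yes refl = [] , F , nil a , ↭-refl
  ... | no a≢b with odd⇒extract F a (trans (h a) (cong₂ _xor_ (eqB-refl a) (eqB-≢ (≢-sym a≢b))))
  trail zero [] a b l h | no a≢b | e , F′ , c , p , j with ↭-length p
  ... | ()
  trail (suc k) F a b l h | no a≢b | e , F′ , c , p , j
    with trail k F′ c b (ℕₚ.≤-pred (subst (_≤ suc k) (↭-length p) l)) h′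
    where
    lem : ∀ x y z → (x xor y) xor (x xor z) ≡ y xor z
    lem true true z = refl
    lem true false z = xor-cancelˡ true z
    lem false y z = refl
    h′ : ∀ v → par F′ v ≡ eqB c v xor eqB b v
    h′ v = trans (par-extract p j v) (trans (cong ((eqB a v xor eqB c v) xor_) (h v)) (lem (eqB a v) (eqB c v) (eqB b v)))
  ... | es , R , w , q = e ∷ es , R , cons e j w , ↭-trans p (prep e q)

  -- The handshake lemma by descent: deleting an edge at the only odd vertex makes the other end of
  -- that edge the only odd vertex, until the edges run out.
  no-single-odd : ∀ k F r → length F ≤ k → (∀ v → par F v ≡ eqB r v) → ⊥
  no-single-odd k F r l h with odd⇒extract F r (trans (h r) (eqB-refl r))
  no-single-odd zero [] r l h | e , F′ , c , p , j with ↭-length p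
  ... | ()
  no-single-odd (suc k) F r l h | e , F′ , c , p , j =
    no-single-odd k F′ c (ℕₚ.≤-pred (subst (_≤ suc k) (↭-length p) l))
      (λ v → trans (par-extract p j v) (trans (cong ((eqB r v xor eqB c v) xor_) (h v))
        (trans (xor-comm (eqB r v xor eqB c v) (eqB r v)) (xor-cancelˡ (eqB r v) (eqB c v)))))

  even-at-root : ∀ F r → (∀ v → v ≢ r → par F v ≡ false) → par F r ≡ false
  even-at-root F r h with par F r in eq
  ... | false = refl
  ... | true = ⊥-elim (no-single-odd (length F) F r ℕₚ.≤-refl lem)
    where
    lem : ∀ v → par F v ≡ eqB r v
    lem v with r ≟ v
    ... | yes refl = eq
    ... | no r≢v = h v (≢-sym r≢v)

  walk-++ : ∀ {a b c es fs} → Walk H a b es → Walk H b c fs → Walk H a c (es ++ fs)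
  walk-++ (nil _) w = w
  walk-++ (cons e j v) w = cons e j (walk-++ v w)

  par-walk : ∀ {a b es} → Walk H a b es → ∀ v → par es v ≡ eqB a v xor eqB b v
  par-walk (nil a) v = sym (xor-same (eqB a v))
  par-walk {a} {b} (cons {v = c} e j w) v = trans (cong₂ _xor_ (inc-joins j v) (par-walk w v))
    (trans (xor-assoc (eqB a v) _ _) (cong (eqB a v xor_) (xor-cancelˡ (eqB c v) _)))

  split-walk : ∀ {a b es x} → Any (Incident H x) es → Walk H a b es →
    ∃ λ fs → ∃ λ gs → Walk H a x fs × Walk H x b gs × es ≡ fs ++ gs
  split-walk {es = es} (here i) (cons e j w) with joins-incident H j i
  ... | inj₁ refl = [] , es , nil _ , cons e j w , refl
  ... | inj₂ refl = e ∷ [] , _ , cons e j (nil _) , w , refl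
  split-walk (there i) (cons e j w) with split-walk i w
  ... | fs , gs , p , q , refl = e ∷ fs , gs , cons e j p , q , refl

  OnTrail : V H → List (Ed H) → V H → Set
  OnTrail u es x = (x ≡ u) ⊎ Any (Incident H x) es

  rotate : ∀ {u es x} → OnTrail u es x → Walk H u u es → ∃ λ fs → Walk H x x fs × es ↭ fs
  rotate (inj₁ refl) w = _ , w , ↭-refl
  rotate (inj₂ i) w with split-walk i w
  ... | fs , gs , p , q , refl = gs ++ fs , walk-++ q p , ++-comm fs gs

  data FReach (F : List (Ed H)) : V H → V H → Set where
    here : ∀ {u} → FReach F u u
    step : ∀ {e u v w} → e ∈ F → Joins H e u v → FReach F v w → FReach F u w

  freach-trans : ∀ {F u v w} → FReach F u v → FReach F v w → FReach F u w
  freach-trans here q = q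
  freach-trans (step e j p) q = step e j (freach-trans p q)

  freach-sym : ∀ {F u v} → FReach F u v → FReach F v u
  freach-sym here = here
  freach-sym (step e j p) = freach-trans (freach-sym p) (step e (joins-sym H j) here)

  freach-mono : ∀ {F F′ u v} → (∀ {e} → e ∈ F → e ∈ F′) → FReach F u v → FReach F′ u v
  freach-mono h here = here
  freach-mono h (step e j p) = step (h e) j (freach-mono h p)

  private
    -- Along a path in `F`, vertices stay on the trail as long as the edges belong to `es`, so the
    -- first edge in `R` starts at a trail vertex. If there is none, `p` itself is on the trail and
    -- `e₀` serves.
    find-exit : ∀ {F u es R p e₀ x} → (∀ {e} → e ∈ F → e ∈ es ++ R) → e₀ ∈ R → Incident H p e₀ →
      OnTrail u es x → FReach F x p → ∃ λ y → ∃ λ e → OnTrail u es y × e ∈ R × Incident H y e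
    find-exit sub e₀∈R i o here = _ , _ , o , e₀∈R , i
    find-exit {es = es} sub e₀∈R i o (step e∈F j r) with ∈-++⁻ es (sub e∈F)
    ... | inj₁ e∈es = find-exit sub e₀∈R i (inj₂ (Any.map (λ { refl → joins⇒incidentʳ H j }) e∈es)) r
    ... | inj₂ e∈R = _ , _ , o , e∈R , joins⇒incidentˡ H j

  -- `R` is even everywhere, as `F` and the closed walk are. An edge `e` of `R` at a trail vertex
  -- `y` is found; without it exactly its two ends are odd in `R`, so `trail` leads back to `y`, and
  -- the new circuit is spliced in there. `R` gets shorter each time.
  hierholzer : ∀ k F r → (∀ v → par F v ≡ false) → (∀ v → FReach F r v) →
    ∀ {u es R} → FReach F u r → Walk H u u es → F ↭ es ++ R → length R ≤ k →
    ∃ λ u′ → ∃ λ fs → Walk H u′ u′ fs × F ↭ fs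
  hierholzer k F r ev con {u} {es} {[]} u⇝r w p l = u , es , w , subst (F ↭_) (++-identityʳ es) p
  hierholzer (suc k) F r ev con {u} {es} {e₀ ∷ R₀} u⇝r w p l
    with find-exit (∈-resp-↭ p) (here refl) (joins⇒incidentˡ H (ends-joins H e₀)) (inj₁ refl)
           (freach-trans u⇝r (con (proj₁ (ends H e₀))))
  ... | y , e , o , e∈R , i with ∈⇒↭∷ e∈R | incident⇒joins H i | rotate o w
  ... | R₁ , q | c , j | fs , wy , t
    with trail (length R₁) R₁ c y ℕₚ.≤-refl
           (λ v → trans (par-extract q j v) (trans (cong ((eqB y v xor eqB c v) xor_) (parR v))
             (trans (xor-identityʳ (eqB y v xor eqB c v)) (xor-comm (eqB y v) (eqB c v)))))
    where
    parR : ∀ v → par (e₀ ∷ R₀) v ≡ false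
    parR v = trans (sym (xor-cancelˡ (par es v) _)) (cong₂ _xor_ (trans (par-walk w v) (xor-same (eqB u v)))
      (trans (sym (par-++ es (e₀ ∷ R₀) v)) (trans (sym (par-↭ p v)) (ev v))))
  ... | gs , R₂ , wc , s =
    hierholzer k F r ev con y⇝r (cons e j (walk-++ wc wy)) perm len
    where
    perm : F ↭ (e ∷ gs ++ fs) ++ R₂
    perm = ↭-trans p (↭-trans (++⁺ t (↭-trans q (prep e s)))
      (subst (fs ++ (e ∷ gs ++ R₂) ↭_) (sym (++-assoc (e ∷ gs) fs R₂)) (shifts fs (e ∷ gs))))
    len : length R₂ ≤ k
    len = ℕₚ.≤-trans (ℕₚ.≤-trans (ℕₚ.m≤n+m (length R₂) (length gs)) (ℕₚ.≤-reflexive (trans (sym (length-++ gs)) (sym (↭-length s)))))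
      (ℕₚ.≤-pred (subst (_≤ suc k) (↭-length q) l))
    y⇝r : FReach F y r
    y⇝r = freach-sym (con y)

  even-connected⇒trail : ∀ {X Y} F r → Unique F → (∀ {e} → e ∈ F → e Subset.∉ Y) → (∀ e → e Subset.∈ X → e ∈ F) →
    (∀ v → v ≢ r → par F v ≡ false) → (∀ v → FReach F r v) → SpanningClosedTrail H X Y
  even-connected⇒trail F r uF F∉Y X⊆F ev con
    with hierholzer (length F) F r ev′ con here (nil r) ↭-refl ℕₚ.≤-refl
    where
    ev′ : ∀ v → par F v ≡ false
    ev′ v with v ≟ r
    ... | yes refl = even-at-root F r ev
    ... | no v≢r = ev v v≢r
  ... | u , es , w , p = u , es , w , unique-resp-↭ p uF , All.tabulate (F∉Y ∘ ∈-resp-↭ (↭-sym p)) ,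
    (λ e e∈X → ∈-resp-↭ p (X⊆F e e∈X)) , cover
    where
    cover : ∀ v → (v ≡ u) ⊎ Any (Incident H v) es
    cover v with freach-trans (freach-sym (con v)) (con u)
    ... | here = inj₁ refl
    ... | step e∈F j _ = inj₂ (Any.map (λ { refl → joins⇒incidentˡ H j }) (∈-resp-↭ p e∈F))

-- Collapsible pieces

module _ (H : Graph) where

  -- Catlin collapsibility of the subgraph (S , P), with the parity prescribed away from the root r;
  -- the parity at r is then forced by the handshake lemma, so T need not be an even set.
  Collapsible : V H → (V H → Set) → (Ed H → Set) → Set
  Collapsible r S P = ∀ (T : V H → Bool) → ∃ λ F → Unique F × (∀ {e} → e ∈ F → P e) ×
    (∀ {v} → S v → v ≢ r → par H F v ≡ T v) × (∀ {v} → S v → FReach H F r v)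

  collapsible-mono : ∀ {r S S′ P P′} → (∀ {v} → S′ v → S v) → (∀ {e} → P e → P′ e) →
    Collapsible r S P → Collapsible r S′ P′
  collapsible-mono s p c T with c T
  ... | F , u , pr , t , k = F , u , p ∘ pr , t ∘ s , k ∘ s

  -- The second piece is solved first, ignoring the other; the first piece then corrects the parity
  -- on all of `S₁`, including `w`, where `F₂` is uncontrolled. Off `S₁` this changes nothing, since
  -- edges in `P₁` have both ends in `S₁`.
  collapsible-merge : ∀ {r w S₁ S₂ P₁ P₂} → (∀ v → Dec (S₁ v)) → S₁ w →
    (∀ {e v} → P₁ e → Incident H v e → S₁ v) → (∀ {e} → P₁ e → P₂ e → ⊥) →
    Collapsible r S₁ P₁ → Collapsible w S₂ P₂ → Collapsible r (λ v → S₁ v ⊎ S₂ v) (λ e → P₁ e ⊎ P₂ e)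
  collapsible-merge {r} {w} {S₁} {S₂} S₁? w∈ within disj c₁ c₂ T with c₂ T
  ... | F₂ , u₂ , p₂ , t₂ , k₂ with c₁ (λ v → T v xor par H F₂ v)
  ... | F₁ , u₁ , p₁ , t₁ , k₁ = F₁ ++ F₂ , Uniqueₚ.++⁺ u₁ u₂ (λ (a , b) → disj (p₁ a) (p₂ b)) ,
    (λ q → [ inj₁ ∘ p₁ , inj₂ ∘ p₂ ]′ (∈-++⁻ F₁ q)) , parity , conn
    where
    par₁ : ∀ {v} → S₁ v → v ≢ r → par H (F₁ ++ F₂) v ≡ T v
    par₁ {v} s v≢r = trans (par-++ H F₁ F₂ v) (trans (cong (_xor par H F₂ v) (t₁ s v≢r))
      (trans (xor-assoc (T v) _ _) (trans (cong (T v xor_) (xor-same (par H F₂ v))) (xor-identityʳ (T v)))))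
    parity : ∀ {v} → S₁ v ⊎ S₂ v → v ≢ r → par H (F₁ ++ F₂) v ≡ T v
    parity (inj₁ s) v≢r = par₁ s v≢r
    parity {v} (inj₂ s) v≢r with S₁? v
    ... | yes s₁ = par₁ s₁ v≢r
    ... | no ¬s₁ = trans (par-++ H F₁ F₂ v) (cong₂ _xor_ (par-∉ H F₁ v (λ q i → ¬s₁ (within (p₁ q) i)))
      (t₂ s (λ { refl → ¬s₁ w∈ })))
    conn : ∀ {v} → S₁ v ⊎ S₂ v → FReach H (F₁ ++ F₂) r v
    conn (inj₁ s) = freach-mono H ∈-++⁺ˡ (k₁ s)
    conn (inj₂ s) = freach-trans H (freach-mono H ∈-++⁺ˡ (k₁ w∈)) (freach-mono H (∈-++⁺ʳ F₁) (k₂ s))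

  -- An odd `v` is attached by `ex` alone, an even one by both edges; either way it is connected.
  -- The parities flipped at `x` and `y` are absorbed by the prescription handed to the old piece.
  collapsible-add : ∀ {r S P v x y ex ey} → ¬ S v → S r → S x → S y → x ≢ y → Joins H ex v x → Joins H ey v y →
    (∀ {e u} → P e → Incident H u e → S u) → Collapsible r S P →
    Collapsible r (λ u → u ≡ v ⊎ S u) (λ e → e ≡ ex ⊎ e ≡ ey ⊎ P e)
  collapsible-add {r} {S} {P} {v} {x} {y} {ex} {ey} v∉ r∈ x∈ y∈ x≢y jx jy within c T = go (T v) refl
    where
    v≢ : ∀ {u} → S u → v ≢ u
    v≢ s refl = v∉ s
    ∉F : ∀ {F e} → Incident H v e → (∀ {f} → f ∈ F → P f) → ∀ {f} → f ∈ F → e ≢ f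
    ∉F i p q refl = v∉ (within (p q) i)
    ex≢ey : ex ≢ ey
    ex≢ey refl = x≢y (other-end-unique H jx jy)
    par-v : ∀ {F} → (∀ {f} → f ∈ F → P f) → par H F v ≡ false
    par-v {F} p = par-∉ H F v (λ q i → v∉ (within (p q) i))
    go : ∀ b → T v ≡ b → ∃ λ F → Unique F × (∀ {e} → e ∈ F → e ≡ ex ⊎ e ≡ ey ⊎ P e) ×
      (∀ {u} → u ≡ v ⊎ S u → u ≢ r → par H F u ≡ T u) × (∀ {u} → u ≡ v ⊎ S u → FReach H F r u)
    go true eq with c (λ u → eqB x u xor T u)
    ... | F , u , p , t , k = ex ∷ F , All.tabulate (∉F (joins⇒incidentˡ H jx) p) ∷ u ,
      (λ { (here q) → inj₁ q ; (there q) → inj₂ (inj₂ (p q)) }) ,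
      (λ { (inj₁ refl) _ → trans (cong₂ _xor_ (inc-end H jx) (par-v p)) (sym eq)
         ; {w} (inj₂ s) w≢r → trans (cong₂ _xor_ (inc-other H jx (v≢ s)) (t s w≢r)) (xor-cancelˡ (eqB x w) (T w)) }) ,
      (λ { (inj₁ refl) → freach-trans H (freach-mono H there (k x∈)) (step (here refl) (joins-sym H jx) here)
         ; (inj₂ s) → freach-mono H there (k s) })
    go false eq with c (λ u → eqB y u xor (eqB x u xor T u))
    ... | F , u , p , t , k = ex ∷ ey ∷ F ,
      (ex≢ey ∷ All.tabulate (∉F (joins⇒incidentˡ H jx) p)) ∷ All.tabulate (∉F (joins⇒incidentˡ H jy) p) ∷ u ,
      (λ { (here q) → inj₁ q ; (there (here q)) → inj₂ (inj₁ q) ; (there (there q)) → inj₂ (inj₂ (p q)) }) ,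
      (λ { (inj₁ refl) _ → trans (cong₂ _xor_ (inc-end H jx) (cong₂ _xor_ (inc-end H jy) (par-v p))) (sym eq)
         ; {w} (inj₂ s) w≢r → trans (cong₂ _xor_ (inc-other H jx (v≢ s)) (cong₂ _xor_ (inc-other H jy (v≢ s)) (t s w≢r)))
             (trans (cong (eqB x w xor_) (xor-cancelˡ (eqB y w) _)) (xor-cancelˡ (eqB x w) (T w))) }) ,
      (λ { (inj₁ refl) → freach-trans H (freach-mono H (there ∘ there) (k x∈)) (step (here refl) (joins-sym H jx) here)
         ; (inj₂ s) → freach-mono H (there ∘ there) (k s) })

  -- The four prescriptions at `a` and `b` are met by the three paths of two edges and the whole
  -- triangle, all of them connected and spanning.
  collapsible-triangle : ∀ {r a b ea eb e} → Joins H ea r a → Joins H eb r b → Joins H e a b →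
    Collapsible r (_∈ r ∷ a ∷ b ∷ []) (_∈ ea ∷ eb ∷ e ∷ [])
  collapsible-triangle {r} {a} {b} {ea} {eb} {e} ja jb j T = go (T a) (T b) refl refl
    where
    r≢a : r ≢ a
    r≢a = adj⇒≢ H (joins⇒adj H ja)
    r≢b : r ≢ b
    r≢b = adj⇒≢ H (joins⇒adj H jb)
    a≢b : a ≢ b
    a≢b = adj⇒≢ H (joins⇒adj H j)
    ea≢eb : ea ≢ eb
    ea≢eb refl = a≢b (other-end-unique H ja jb)
    ea≢e : ea ≢ e
    ea≢e refl = r≢b (other-end-unique H (joins-sym H ja) j)
    eb≢e : eb ≢ e
    eb≢e refl = r≢a (other-end-unique H (joins-sym H jb) (joins-sym H j))
    eaa : inc H ea a ≡ true
    eaa = inc-end H (joins-sym H ja)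
    eab : inc H ea b ≡ false
    eab = trans (inc-other H ja r≢b) (eqB-≢ a≢b)
    eba : inc H eb a ≡ false
    eba = trans (inc-other H jb r≢a) (eqB-≢ (≢-sym a≢b))
    ebb : inc H eb b ≡ true
    ebb = inc-end H (joins-sym H jb)
    ea′ : inc H e a ≡ true
    ea′ = inc-end H j
    eb′ : inc H e b ≡ true
    eb′ = inc-end H (joins-sym H j)
    Result : Set
    Result = ∃ λ F → Unique F × (∀ {f} → f ∈ F → f ∈ ea ∷ eb ∷ e ∷ []) ×
      (∀ {u} → u ∈ r ∷ a ∷ b ∷ [] → u ≢ r → par H F u ≡ T u) × (∀ {u} → u ∈ r ∷ a ∷ b ∷ [] → FReach H F r u)
    build : ∀ F → Unique F → (∀ {f} → f ∈ F → f ∈ ea ∷ eb ∷ e ∷ []) → par H F a ≡ T a → par H F b ≡ T b →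
      FReach H F r a → FReach H F r b → Result
    build F u s pa pb ra rb = F , u , s ,
      (λ { (here refl) x → ⊥-elim (x refl) ; (there (here refl)) _ → pa ; (there (there (here refl))) _ → pb }) ,
      (λ { (here refl) → here ; (there (here refl)) → ra ; (there (there (here refl))) → rb })
    go : ∀ x y → T a ≡ x → T b ≡ y → Result
    go true true ta tb = build (ea ∷ eb ∷ []) ((ea≢eb ∷ []) ∷ [] ∷ [])
      (λ { (here q) → here q ; (there (here q)) → there (here q) })
      (trans (cong₂ (λ p q → p xor (q xor false)) eaa eba) (sym ta))
      (trans (cong₂ (λ p q → p xor (q xor false)) eab ebb) (sym tb))
      (step (here refl) ja here) (step (there (here refl)) jb here)
    go true false ta tb = build (eb ∷ e ∷ []) ((eb≢e ∷ []) ∷ [] ∷ []) there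
      (trans (cong₂ (λ p q → p xor (q xor false)) eba ea′) (sym ta))
      (trans (cong₂ (λ p q → p xor (q xor false)) ebb eb′) (sym tb))
      (step (here refl) jb (step (there (here refl)) (joins-sym H j) here)) (step (here refl) jb here)
    go false true ta tb = build (ea ∷ e ∷ []) ((ea≢e ∷ []) ∷ [] ∷ [])
      (λ { (here q) → here q ; (there q) → there (there q) })
      (trans (cong₂ (λ p q → p xor (q xor false)) eaa ea′) (sym ta))
      (trans (cong₂ (λ p q → p xor (q xor false)) eab eb′) (sym tb))
      (step (here refl) ja here) (step (here refl) ja (step (there (here refl)) j here))
    go false false ta tb = build (ea ∷ eb ∷ e ∷ []) ((ea≢eb ∷ ea≢e ∷ []) ∷ (eb≢e ∷ []) ∷ [] ∷ []) id
      (trans (cong₂ (λ p q → p xor q) eaa (cong₂ (λ p q → p xor (q xor false)) eba ea′)) (sym ta))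
      (trans (cong₂ (λ p q → p xor q) eab (cong₂ (λ p q → p xor (q xor false)) ebb eb′)) (sym tb))
      (step (here refl) ja here) (step (there (here refl)) jb here)

  -- Pigeonhole: edges from `v` to distinct neighbours are distinct, so a neighbour whose edge lies
  -- in `Z` can be struck off together with that edge.
  avoiding-edge : ∀ v S Z → Unique S → (∀ {u} → u ∈ S → Adj H v u) → length Z < length S →
    ∃ λ u → ∃ λ e → u ∈ S × Joins H e v u × e ∉ Z
  avoiding-edge v (u ∷ S) Z (u∉ ∷ us) adj l with edge H (adj (here refl))
  ... | e , j with Any.any? (e ≟_) Z
  ... | no e∉Z = u , e , here refl , j , e∉Z
  ... | yes e∈Z with ∈⇒↭∷ e∈Z
  ... | Z′ , p with avoiding-edge v S Z′ us (adj ∘ there) (ℕₚ.≤-pred (subst (λ k → suc k ≤ suc (length S)) (↭-length p) l))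
  ... | w , f , w∈ , k , f∉ = w , f , there w∈ , k , λ q → case ∈-resp-↭ p q of λ
    { (here refl) → All.lookup u∉ w∈ (other-end-unique H j k) ; (there q′) → f∉ q′ }

  two-avoiding-edges : ∀ v S Z → Unique S → (∀ {u} → u ∈ S → Adj H v u) → suc (length Z) < length S →
    ∃ λ x → ∃ λ y → ∃ λ ex → ∃ λ ey → x ∈ S × y ∈ S × x ≢ y × Joins H ex v x × Joins H ey v y × ex ∉ Z × ey ∉ Z
  two-avoiding-edges v S Z us adj l with avoiding-edge v S Z us adj (ℕₚ.<-trans (ℕₚ.n<1+n _) l)
  ... | x , ex , x∈ , jx , ex∉ with ∈⇒↭∷ x∈
  ... | S′ , p with unique-resp-↭ p us
  ... | x∉ ∷ us′ with avoiding-edge v S′ Z us′ (λ q → adj (∈-resp-↭ (↭-sym p) (there q)))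
                       (ℕₚ.≤-pred (subst (suc (suc (length Z)) ≤_) (↭-length p) l))
  ... | y , ey , y∈ , jy , ey∉ = x , y , ex , ey , x∈ , ∈-resp-↭ (↭-sym p) (there y∈) , All.lookup x∉ y∈ , jx , jy , ex∉ , ey∉

  CliqueEdge : List (V H) → List (Ed H) → Ed H → Set
  CliqueEdge S Z e = e ∉ Z × (∀ {u} → Incident H u e → u ∈ S)

  private
    -- Removing v from the clique destroys the forbidden edge z.
    remove-for : ∀ {r w W} → Unique (r ∷ w ∷ W) → ∀ z →
      ∃ λ v → ∃ λ W′ → (w ∷ W) ↭ v ∷ W′ × ∃ λ p → Incident H p z × p ∉ r ∷ W′
    remove-for {r} {w} {W} (r∉ ∷ u) z = go
      where
      p q : V H
      p = proj₁ (ends H z)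
      q = proj₂ (ends H z)
      pick : ∀ {x} → x ∈ w ∷ W → Incident H x z → ∃ λ v → ∃ λ W′ → (w ∷ W) ↭ v ∷ W′ × ∃ λ p → Incident H p z × p ∉ r ∷ W′
      pick {x} x∈ i with ∈⇒↭∷ x∈
      ... | W′ , s with unique-resp-↭ s u
      ... | x∉ ∷ _ = x , W′ , s , x , i , λ { (here refl) → All.lookup r∉ x∈ refl ; (there t) → All.lookup x∉ t refl }
      outside : ∀ {x} → x ∉ w ∷ W → x ≢ r → x ∉ r ∷ W
      outside x∉ x≢r (here e) = x≢r e
      outside x∉ x≢r (there t) = x∉ (there t)
      go : ∃ λ v → ∃ λ W′ → (w ∷ W) ↭ v ∷ W′ × ∃ λ p → Incident H p z × p ∉ r ∷ W′
      go with Any.any? (p ≟_) (w ∷ W) | Any.any? (q ≟_) (w ∷ W)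
      ... | yes p∈ | _ = pick p∈ (inj₁ refl)
      ... | no _ | yes q∈ = pick q∈ (inj₂ refl)
      -- The distinct ends of `z` cannot both be `r`, so `z` already has an end outside the clique,
      -- and any vertex but the root may be removed.
      ... | no p∉ | no q∉ with p ≟ r
      ... | no p≢r = w , W , ↭-refl , p , inj₁ refl , outside p∉ p≢r
      ... | yes p≡r = w , W , ↭-refl , q , inj₂ refl ,
        outside q∉ (λ q≡r → adj⇒≢ H (ends-adj H z) (trans p≡r (sym q≡r)))

  -- Induction by setting aside a vertex `v` of `W`, never the root, so that one forbidden edge
  -- drops out. The numbers balance: for `suc k`, `v` is adjacent to the `3 + k` remaining vertices
  -- and at most `1 + k` edges are forbidden, which leaves two edges for `collapsible-add`.
  clique-collapsible : ∀ k r W Z → length W ≡ 2 + k → length Z ≤ k → Unique (r ∷ W) →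
    (∀ {u v} → u ∈ r ∷ W → v ∈ r ∷ W → u ≢ v → Adj H u v) → Collapsible r (_∈ r ∷ W) (CliqueEdge (r ∷ W) Z)
  clique-collapsible zero r (a ∷ b ∷ []) [] refl _ ((r≢a ∷ r≢b ∷ []) ∷ (a≢b ∷ []) ∷ _) adj
    with edge H (adj (here refl) (there (here refl)) r≢a) | edge H (adj (here refl) (there (there (here refl))) r≢b)
       | edge H (adj (there (here refl)) (there (there (here refl))) a≢b)
  ... | ea , ja | eb , jb | e , j = collapsible-mono id
    (λ { (here refl) → in-clique ja (here refl) (there (here refl))
       ; (there (here refl)) → in-clique jb (here refl) (there (there (here refl)))
       ; (there (there (here refl))) → in-clique j (there (here refl)) (there (there (here refl))) })
    (collapsible-triangle ja jb j)
    where
    in-clique : ∀ {f x y} → Joins H f x y → x ∈ r ∷ a ∷ b ∷ [] → y ∈ r ∷ a ∷ b ∷ [] → CliqueEdge (r ∷ a ∷ b ∷ []) [] f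
    in-clique {f} {x} {y} jf x∈ y∈ = (λ ()) , within
      where
      within : ∀ {u} → Incident H u f → u ∈ r ∷ a ∷ b ∷ []
      within i with joins-incident H jf i
      ... | inj₁ refl = x∈
      ... | inj₂ refl = y∈
  clique-collapsible (suc k) r (w ∷ W) Z lW lZ u adj = go Z refl
    where
    extend : ∀ {v W′ Z′} → (w ∷ W) ↭ v ∷ W′ → length Z ≤ suc k → length Z′ ≤ k →
      (∀ {e} → CliqueEdge (r ∷ W′) Z′ e → e ∉ Z) → Collapsible r (_∈ r ∷ w ∷ W) (CliqueEdge (r ∷ w ∷ W) Z)
    extend {v} {W′} {Z′} p lZ lZ′ avoid = fin (two-avoiding-edges v (r ∷ W′) Z u′ (λ q → adj v∈ (sub q) (v≢ q))
        (subst (λ l → suc (suc (length Z)) ≤ suc l) (sym lW′) (s≤s (s≤s lZ))))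
      where
      full : (r ∷ w ∷ W) ↭ v ∷ r ∷ W′
      full = ↭-trans (prep r p) (swap r v ↭-refl)
      uv : Unique (v ∷ r ∷ W′)
      uv = unique-resp-↭ full u
      u′ : Unique (r ∷ W′)
      u′ = AllPairs.tail uv
      v≢ : ∀ {x} → x ∈ r ∷ W′ → v ≢ x
      v≢ = All.lookup (AllPairs.head uv)
      sub : ∀ {x} → x ∈ r ∷ W′ → x ∈ r ∷ w ∷ W
      sub q = ∈-resp-↭ (↭-sym full) (there q)
      v∈ : v ∈ r ∷ w ∷ W
      v∈ = ∈-resp-↭ (↭-sym full) (here refl)
      lW′ : length W′ ≡ 2 + k
      lW′ = ℕₚ.suc-injective (trans (sym (↭-length p)) lW)
      fin : (∃ λ x → ∃ λ y → ∃ λ ex → ∃ λ ey → x ∈ r ∷ W′ × y ∈ r ∷ W′ × x ≢ y × Joins H ex v x × Joins H ey v y × ex ∉ Z × ey ∉ Z) →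
        Collapsible r (_∈ r ∷ w ∷ W) (CliqueEdge (r ∷ w ∷ W) Z)
      fin (x , y , ex , ey , x∈ , y∈ , x≢y , jx , jy , ex∉ , ey∉) =
        collapsible-mono (λ q → case ∈-resp-↭ full q of λ { (here e) → inj₁ e ; (there t) → inj₂ t })
          widen
          (collapsible-add (λ q → v≢ q refl) (here refl) x∈ y∈ x≢y jx jy (λ (_ , i) → i)
            (clique-collapsible k r W′ Z′ lW′ lZ′ u′ (λ a b → adj (sub a) (sub b))))
        where
        ends-in : ∀ {f z} → Joins H f v z → z ∈ r ∷ W′ → ∀ {s} → Incident H s f → s ∈ r ∷ w ∷ W
        ends-in j z∈ i with joins-incident H j i
        ... | inj₁ refl = v∈
        ... | inj₂ refl = sub z∈
        widen : ∀ {f} → f ≡ ex ⊎ f ≡ ey ⊎ CliqueEdge (r ∷ W′) Z′ f → CliqueEdge (r ∷ w ∷ W) Z f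
        widen (inj₁ refl) = ex∉ , λ i → ends-in jx x∈ i
        widen (inj₂ (inj₁ refl)) = ey∉ , λ i → ends-in jy y∈ i
        widen (inj₂ (inj₂ c@(_ , i))) = avoid c , λ t → sub (i t)
    go : ∀ Z₁ → Z ≡ Z₁ → Collapsible r (_∈ r ∷ w ∷ W) (CliqueEdge (r ∷ w ∷ W) Z)
    go [] refl = extend {Z′ = []} ↭-refl z≤n z≤n (λ _ ())
    go (z ∷ Z₁) refl with remove-for u z
    ... | v , W′ , p , x , i , x∉ = extend p lZ (ℕₚ.≤-pred lZ)
      (λ { (_ , within) (here refl) → x∉ (within i) ; (e∉ , _) (there q) → e∉ q })

-- Line graphs

∨-split : ∀ {a b} → a ∨ b ≡ true → (a ≡ true) ⊎ (b ≡ true)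
∨-split {true} p = inj₁ refl
∨-split {false} p = inj₂ p

∨-left : ∀ {a b} → a ≡ true → a ∨ b ≡ true
∨-left refl = refl

∨-right : ∀ a {b} → b ≡ true → a ∨ b ≡ true
∨-right true _ = refl
∨-right false p = p

eqB⇒≡ : ∀ {k} {a b : Fin k} → eqB a b ≡ true → a ≡ b
eqB⇒≡ {a = a} {b} p with a ≟ b
... | yes q = q
eqB⇒≡ () | no _

shareEnd⁻ : ∀ {k} {p q : Fin k × Fin k} → shareEnd p q ≡ true →
  ∃ λ v → ((proj₁ p ≡ v) ⊎ (proj₂ p ≡ v)) × ((proj₁ q ≡ v) ⊎ (proj₂ q ≡ v))
shareEnd⁻ {p = a , b} {c , d} h with ∨-split {eqB a c} h
... | inj₁ e = a , inj₁ refl , inj₁ (sym (eqB⇒≡ e))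
... | inj₂ h₁ with ∨-split {eqB a d} h₁
... | inj₁ e = a , inj₁ refl , inj₂ (sym (eqB⇒≡ e))
... | inj₂ h₂ with ∨-split {eqB b c} h₂
... | inj₁ e = b , inj₂ refl , inj₁ (sym (eqB⇒≡ e))
... | inj₂ e = b , inj₂ refl , inj₂ (sym (eqB⇒≡ e))

shareEnd⁺ : ∀ {k} {p q : Fin k × Fin k} {v} → (proj₁ p ≡ v) ⊎ (proj₂ p ≡ v) → (proj₁ q ≡ v) ⊎ (proj₂ q ≡ v) → shareEnd p q ≡ true
shareEnd⁺ {p = a , b} {c , d} (inj₁ refl) (inj₁ refl) = ∨-left (eqB-refl a)
shareEnd⁺ {p = a , b} {c , d} (inj₁ refl) (inj₂ refl) = ∨-right (eqB a c) (∨-left (eqB-refl a))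
shareEnd⁺ {p = a , b} {c , d} (inj₂ refl) (inj₁ refl) = ∨-right (eqB a c) (∨-right (eqB a d) (∨-left (eqB-refl b)))
shareEnd⁺ {p = a , b} {c , d} (inj₂ refl) (inj₂ refl) = ∨-right (eqB a c) (∨-right (eqB a d) (∨-right (eqB b c) (eqB-refl b)))

module _ (G : Graph) where

  L-adj⁺ : ∀ {e f v} → e ≢ f → Incident G v e → Incident G v f → Adj (L G) e f
  L-adj⁺ {e} {f} e≢f i j with e ≟ f
  ... | yes p = ⊥-elim (e≢f p)
  ... | no _ = ∨-left (shareEnd⁺ i j)

  L-adj⁻ : ∀ {e f} → Adj (L G) e f → ∃ λ v → Incident G v e × Incident G v f
  L-adj⁻ {e} {f} a with e ≟ f
  L-adj⁻ () | yes _
  ... | no _ with ∨-split {shareEnd (ends G e) (ends G f)} a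
  ... | inj₁ p = shareEnd⁻ p
  ... | inj₂ p with shareEnd⁻ p
  ... | v , i , j = v , j , i

  adj⇒common-edge : ∀ {u v} → Adj G u v → ∃ λ e → Incident G u e × Incident G v e
  adj⇒common-edge a = let e , j = edge G a in e , joins⇒incidentˡ G j , joins⇒incidentʳ G j

  incident₂⇒joins : ∀ {u v e} → u ≢ v → Incident G u e → Incident G v e → Joins G e u v
  incident₂⇒joins u≢v i j with incident⇒joins G i
  ... | w , k with joins-incident G k j
  ... | inj₁ u≡v = ⊥-elim (u≢v u≡v)
  ... | inj₂ refl = k

  -- Two edges sharing both ends would be parallel.
  common-vertex-unique : ∀ {u v e f} → e ≢ f → Incident G u e → Incident G u f → Incident G v e → Incident G v f → u ≡ v
  common-vertex-unique {u} {v} e≢f ue uf ve vf with u ≟ v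
  ... | yes p = p
  ... | no u≢v = ⊥-elim (e≢f (joins-unique G (incident₂⇒joins u≢v ue ve) (incident₂⇒joins u≢v uf vf)))

  edges-to : ∀ v ns → Unique ns → (∀ {w} → w ∈ ns → Adj G v w) →
    ∃ λ es → Unique es × length es ≡ length ns × (∀ {e} → e ∈ es → ∃ λ w → w ∈ ns × Joins G e v w) ×
             (∀ {e w} → w ∈ ns → Joins G e v w → e ∈ es)
  edges-to v [] _ _ = [] , [] , refl , (λ ()) , λ ()
  edges-to v (w ∷ ns) (w∉ ∷ u) a with edge G (a (here refl)) | edges-to v ns u (a ∘ there)
  ... | e , j | es , ues , l , to , from = e ∷ es ,
    All.tabulate (λ {f} f∈ → λ { refl → let x , x∈ , k = to f∈ in All.lookup w∉ x∈ (other-end-unique G j k) }) ∷ ues ,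
    cong suc l ,
    (λ { (here refl) → w , here refl , j ; (there q) → let x , x∈ , k = to q in x , there x∈ , k }) ,
    (λ { (here refl) k → here (joins-unique G k j) ; (there q) k → there (from q k) })

  star : ∀ v → ∃ λ es → Unique es × length es ≡ deg G v × (∀ {e} → e ∈ es → Incident G v e) × (∀ {e} → Incident G v e → e ∈ es)
  star v with edges-to v (nbrs G v) (nbrs-unique G v) (∈-nbrs⁻ G)
  ... | es , u , l , to , from = es , u , trans l (sym (deg≡length-nbrs G v)) ,
    (λ q → joins⇒incidentˡ G (proj₂ (proj₂ (to q)))) ,
    λ i → let w , j = incident⇒joins G i in from (∈-nbrs⁺ G (joins⇒adj G j)) j

  -- The given edge comes first because it becomes the root of the clique at `v`.
  star-at : ∀ {v e} → Incident G v e → ∃ λ es → Unique (e ∷ es) × suc (length es) ≡ deg G v ×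
    (∀ {f} → f ∈ e ∷ es → Incident G v f) × (∀ {f} → Incident G v f → f ∈ e ∷ es)
  star-at {v} i with star v
  ... | fs , u , l , to , from with ∈⇒↭∷ (from i)
  ... | es , p = es , unique-resp-↭ p u , trans (sym (↭-length p)) l , to ∘ ∈-resp-↭ (↭-sym p) , ∈-resp-↭ p ∘ from

  -- Without `e`, the stars at `u` and `v` are disjoint, as there are no parallel edges, and
  -- together they form the neighbourhood of `e` in `L G`.
  deg-L : ∀ {e u v} → Joins G e u v → deg G u + deg G v ≡ 2 + deg (L G) e
  deg-L {e} {u} {v} j with star-at (joins⇒incidentˡ G j) | star-at (joins⇒incidentʳ G j)
  ... | A , e∉A ∷ uA , lA , toA , fromA | B , e∉B ∷ uB , lB , toB , fromB =
    trans (cong₂ _+_ (sym lA) (sym lB)) (cong suc (trans (ℕₚ.+-suc (length A) (length B))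
      (cong suc (trans (sym (length-++ A)) (ℕₚ.≤-antisym
        (length≤deg (L G) (Uniqueₚ.++⁺ uA uB disj) to) (deg≤length (L G) from))))))
    where
    disj : ∀ {f} → ¬ (f ∈ A × f ∈ B)
    disj {f} (a , b) = All.lookup e∉A a (sym (joins-unique G
      (incident₂⇒joins (adj⇒≢ G (joins⇒adj G j)) (toA (there a)) (toB (there b))) j))
    to : ∀ {f} → f ∈ A ++ B → Adj (L G) e f
    to q with ∈-++⁻ A q
    ... | inj₁ a = L-adj⁺ (All.lookup e∉A a) (joins⇒incidentˡ G j) (toA (there a))
    ... | inj₂ b = L-adj⁺ (All.lookup e∉B b) (joins⇒incidentʳ G j) (toB (there b))
    from : ∀ {f} → Adj (L G) e f → f ∈ A ++ B
    from {f} a with L-adj⁻ a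
    ... | x , xe , xf with joins-incident G j xe
    ... | inj₁ refl with fromA xf
    ... | here refl = ⊥-elim (adj-irrefl (L G) a)
    ... | there q = ∈-++⁺ˡ q
    from {f} a | x , xe , xf | inj₂ refl with fromB xf
    ... | here refl = ⊥-elim (adj-irrefl (L G) a)
    ... | there q = ∈-++⁺ʳ A q

  L-reach : ∀ {u w} → Reach G u w → ∀ {e f} → Incident G u e → Incident G w f → Reach (L G) e f
  L-reach {u} here {e} {f} i j with e ≟ f
  ... | yes refl = here
  ... | no e≢f = step (L-adj⁺ e≢f i j) here
  L-reach {u} (step {v = v} a r) {e} i k with edge G a
  ... | g , j with e ≟ g
  ... | yes refl = L-reach r (joins⇒incidentʳ G j) k
  ... | no e≢g = step (L-adj⁺ e≢g i (joins⇒incidentˡ G j)) (L-reach r (joins⇒incidentʳ G j) k)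

  L-connected : (∀ u v → Reach G u v) → ∀ e f → Reach (L G) e f
  L-connected c e f = L-reach (c (proj₁ (ends G e)) (proj₁ (ends G f))) (inj₁ refl) (inj₁ refl)

-- Subsets as lists

elements : ∀ {k} → Subset.Subset k → List (Fin k)
elements Vec.[] = []
elements (true Vec.∷ S) = zero ∷ map suc (elements S)
elements (false Vec.∷ S) = map suc (elements S)

length-elements : ∀ {k} (S : Subset.Subset k) → length (elements S) ≡ Subset.∣ S ∣
length-elements Vec.[] = refl
length-elements (true Vec.∷ S) = cong suc (trans (length-map suc (elements S)) (length-elements S))
length-elements (false Vec.∷ S) = trans (length-map suc (elements S)) (length-elements S)

elements-unique : ∀ {k} (S : Subset.Subset k) → Unique (elements S)
elements-unique Vec.[] = []
elements-unique (true Vec.∷ S) = Allₚ.map⁺ (All.universal (λ _ ()) _) ∷ Uniqueₚ.map⁺ Finₚ.suc-injective (elements-unique S)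
elements-unique (false Vec.∷ S) = Uniqueₚ.map⁺ Finₚ.suc-injective (elements-unique S)

∈-elements⁺ : ∀ {k} (S : Subset.Subset k) {x} → x Subset.∈ S → x ∈ elements S
∈-elements⁺ (true Vec.∷ S) {zero} _ = here refl
∈-elements⁺ (true Vec.∷ S) {suc x} (Vec.there p) = there (∈-map⁺ suc (∈-elements⁺ S p))
∈-elements⁺ (false Vec.∷ S) {suc x} (Vec.there p) = ∈-map⁺ suc (∈-elements⁺ S p)

∈-elements⁻ : ∀ {k} (S : Subset.Subset k) {x} → x ∈ elements S → x Subset.∈ S
∈-elements⁻ (true Vec.∷ S) (here refl) = Vec.here
∈-elements⁻ (true Vec.∷ S) (there q) with ∈-map⁻ suc q
... | y , y∈ , refl = Vec.there (∈-elements⁻ S y∈)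
∈-elements⁻ (false Vec.∷ S) q with ∈-map⁻ suc q
... | y , y∈ , refl = Vec.there (∈-elements⁻ S y∈)

data Within {A : Set} (_~_ : A → A → Set) (U : A → Set) : A → A → Set where
  here : ∀ {u} → Within _~_ U u u
  step : ∀ {u v w} → u ~ v → U v → Within _~_ U v w → Within _~_ U u w

-- A graph H whose edge set is partitioned into cliques, as for a line graph: On v e says that e lies in the clique v.

module CliquePartition (H : Graph) (N : ℕ) (d : Fin N → ℕ) (On : Fin N → V H → Set) (on? : ∀ v e → Dec (On v e))
  (clique : ∀ {v e f} → e ≢ f → On v e → On v f → Adj H e f)
  (linear : ∀ {u v e f} → e ≢ f → On u e → On u f → On v e → On v f → u ≡ v)
  (star-at : ∀ {v e} → On v e → ∃ λ es → Unique (e ∷ es) × suc (length es) ≡ d v ×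
    (∀ {f} → f ∈ e ∷ es → On v f) × (∀ {f} → On v f → f ∈ e ∷ es))
  (_~_ : Fin N → Fin N → Set) (common : ∀ {u v} → u ~ v → ∃ λ e → On u e × On v e) where

  InClique : Fin N → Ed H → Set
  InClique v ε = On v (proj₁ (ends H ε)) × On v (proj₂ (ends H ε))

  inClique? : ∀ v ε → Dec (InClique v ε)
  inClique? v ε = on? v _ ×-dec on? v _

  inClique-end : ∀ {v ε e} → InClique v ε → Incident H e ε → On v e
  inClique-end (a , b) (inj₁ refl) = a
  inClique-end (a , b) (inj₂ refl) = b

  -- The two ends of `ε` are distinct vertices common to both cliques. This is what keeps different
  -- cliques edge-disjoint when they are merged.
  inClique-unique : ∀ {u v ε} → InClique u ε → InClique v ε → u ≡ v
  inClique-unique {ε = ε} (a , b) (c , e) = linear (adj⇒≢ H (ends-adj H ε)) a b c e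

  -- Only the forbidden edges inside the clique count, hence the filter. The clique is `r` together
  -- with `W`, so the parameter `length W ∸ 2` equals `d v ∸ 3`.
  star-clique-collapsible : ∀ Z {v r} → length (filter (inClique? v) Z) + 3 ≤ d v → On v r →
    Collapsible H r (On v) (λ ε → ε ∉ Z × InClique v ε)
  star-clique-collapsible Z {v} {r} big i with star-at i
  ... | W , u , l , to , from = collapsible-mono H from edges
    (clique-collapsible H (length W ∸ 2) r W Zv
      (sym (ℕₚ.m+[n∸m]≡n 2≤W)) (ℕₚ.+-cancelˡ-≤ 2 _ _ (subst (2 + length Zv ≤_) (sym (ℕₚ.m+[n∸m]≡n 2≤W)) Z+2≤W)) u
      (λ a b e≢f → clique e≢f (to a) (to b)))
    where
    Zv = filter (inClique? v) Z
    Z+2≤W : 2 + length Zv ≤ length W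
    Z+2≤W = ℕₚ.≤-pred (subst₂ _≤_ (ℕₚ.+-comm (length Zv) 3) (sym l) big)
    2≤W : 2 ≤ length W
    2≤W = ℕₚ.≤-trans (ℕₚ.m≤m+n 2 _) Z+2≤W
    edges : ∀ {ε} → CliqueEdge H (r ∷ W) Zv ε → ε ∉ Z × InClique v ε
    edges (ε∉ , ends∈) = (λ q → ε∉ (∈-filter⁺ (inClique? v) q c)) , c
      where c = to (ends∈ (inj₁ refl)) , to (ends∈ (inj₂ refl))

  module Core (U : Fin N → Set) (U? : ∀ v → Dec (U v)) (Z : List (Ed H))
              (big : ∀ {v} → U v → length (filter (inClique? v) Z) + 3 ≤ d v) (r : V H) where

    CoreEdge : List (Fin N) → Ed H → Set
    CoreEdge Ps ε = ε ∉ Z × ∃ λ v → v ∈ Ps × U v × InClique v ε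

    Touched : List (Fin N) → V H → Set
    Touched Ps e = ∃ λ v → v ∈ Ps × On v e

    touched? : ∀ Ps e → Dec (Touched Ps e)
    touched? Ps e with Any.any? (λ v → on? v e) Ps
    ... | yes a = let v , v∈ , o = find a in yes (v , v∈ , o)
    ... | no ¬a = no (λ (v , v∈ , o) → ¬a (lose v∈ o))

    Covered : List (Fin N) → Set
    Covered Ps = Collapsible H r (Touched Ps) (CoreEdge Ps)

    -- The vertex `w` shared by the cliques `p` and `v` is taken as the root of the new piece, where
    -- `collapsible-merge` needs no control over its parity.
    covered-cons : ∀ {Ps p v w} → p ∈ Ps → v ∉ Ps → On p w → On v w → U v → Covered Ps → Covered (v ∷ Ps)
    covered-cons {Ps} {p} {v} {w} p∈ v∉ ow vw uv c = collapsible-mono H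
      {S = λ e → Touched Ps e ⊎ On v e} {P = λ ε → CoreEdge Ps ε ⊎ (ε ∉ Z × InClique v ε)} vertices edges
      (collapsible-merge H (touched? Ps) (p , p∈ , ow) within disjoint c (star-clique-collapsible Z (big uv) vw))
      where
      vertices : ∀ {e} → Touched (v ∷ Ps) e → Touched Ps e ⊎ On v e
      vertices (_ , here refl , o) = inj₂ o
      vertices (x , there q , o) = inj₁ (x , q , o)
      edges : ∀ {ε} → CoreEdge Ps ε ⊎ (ε ∉ Z × InClique v ε) → CoreEdge (v ∷ Ps) ε
      edges (inj₁ (z , x , q , ux , k)) = z , x , there q , ux , k
      edges (inj₂ (z , k)) = z , v , here refl , uv , k
      within : ∀ {ε e} → CoreEdge Ps ε → Incident H e ε → Touched Ps e
      within (_ , x , q , _ , k) i = x , q , inClique-end k i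
      disjoint : ∀ {ε} → CoreEdge Ps ε → ε ∉ Z × InClique v ε → ⊥
      disjoint (_ , x , q , _ , k) (_ , k′) with inClique-unique k k′
      ... | refl = v∉ q

    covered-extend : ∀ {Ps p v} → p ∈ Ps → p ~ v → U v → Covered Ps → ∃ λ Ps′ → Covered Ps′ × v ∈ Ps′ × (∀ {x} → x ∈ Ps → x ∈ Ps′)
    covered-extend {Ps} {p} {v} p∈ a uv c with Any.any? (v ≟_) Ps
    ... | yes v∈ = Ps , c , v∈ , id
    ... | no v∉ = let w , ow , vw = common a in v ∷ Ps , covered-cons p∈ v∉ ow vw uv c , here refl , there

    covered-along : ∀ {Ps p v} → p ∈ Ps → Within _~_ U p v → Covered Ps → ∃ λ Ps′ → Covered Ps′ × v ∈ Ps′ × (∀ {x} → x ∈ Ps → x ∈ Ps′)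
    covered-along {Ps} p∈ here c = Ps , c , p∈ , id
    covered-along p∈ (step a ux w) c with covered-extend p∈ a ux c
    ... | Ps₁ , c₁ , x∈ , s₁ with covered-along x∈ w c₁
    ... | Ps₂ , c₂ , v∈ , s₂ = Ps₂ , c₂ , v∈ , s₂ ∘ s₁

    covered-all : ∀ {u₀} → (∀ {v} → U v → Within _~_ U u₀ v) → ∀ vs {Ps} → u₀ ∈ Ps → Covered Ps →
      ∃ λ Ps′ → Covered Ps′ × (∀ {x} → x ∈ Ps → x ∈ Ps′) × (∀ {v} → v ∈ vs → U v → v ∈ Ps′)
    covered-all w [] {Ps} u₀∈ c = Ps , c , id , λ ()
    covered-all w (v ∷ vs) u₀∈ c with covered-all w vs u₀∈ c
    ... | Ps₁ , c₁ , s₁ , t₁ with U? v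
    ... | no ¬u = Ps₁ , c₁ , s₁ , λ { (here refl) u → ⊥-elim (¬u u) ; (there q) u → t₁ q u }
    ... | yes u with covered-along (s₁ u₀∈) (w u) c₁
    ... | Ps₂ , c₂ , v∈ , s₂ = Ps₂ , c₂ , s₂ ∘ s₁ , λ { (here refl) _ → v∈ ; (there q) u → s₂ (t₁ q u) }

    core-collapsible : ∀ {u₀} → U u₀ → On u₀ r → (∀ {v} → U v → Within _~_ U u₀ v) →
      Collapsible H r (λ e → ∃ λ v → U v × On v e) (λ ε → ε ∉ Z × ∃ λ v → U v × InClique v ε)
    core-collapsible {u₀} uu o w = fin (covered-all w (allFin N) {u₀ ∷ []} (here refl) start)
      where
      start : Covered (u₀ ∷ [])
      start = collapsible-mono H (λ { (_ , here refl , o′) → o′ }) (λ (z , k) → z , u₀ , here refl , uu , k)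
        (star-clique-collapsible Z (big uu) o)
      fin : (∃ λ Ps → Covered Ps × (∀ {x} → x ∈ u₀ ∷ [] → x ∈ Ps) × (∀ {v} → v ∈ allFin N → U v → v ∈ Ps)) →
        Collapsible H r (λ e → ∃ λ v → U v × On v e) (λ ε → ε ∉ Z × ∃ λ v → U v × InClique v ε)
      fin (Ps , c , _ , t) = collapsible-mono H (λ (v , uv , ov) → v , t (∈-allFin v) uv , ov)
        (λ (z , v , _ , uv , k) → z , v , uv , k) c

  -- The core, consisting of the cliques in U, is joined up by a subgraph whose odd vertices are those of X.
  spanning-trail : ∀ (U : Fin N → Set) (U? : ∀ v → Dec (U v)) (X Y : List (Ed H)) {Xs Ys} →
    Unique X → (∀ {ε} → ε ∈ X → ε Subset.∉ Ys) → (∀ ε → ε Subset.∈ Xs → ε ∈ X) → (∀ {ε} → ε Subset.∈ Ys → ε ∈ Y) →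
    (∀ {v} → U v → length (filter (inClique? v) (X ++ Y)) + 3 ≤ d v) →
    ∀ {u₀ r} → U u₀ → On u₀ r → (∀ {v} → U v → Within _~_ U u₀ v) →
    (∀ e → ¬ (∃ λ v → U v × On v e) → par H X e ≡ false × ∃ λ f → (∃ λ v → U v × On v f) × FReach H X f e) →
    SpanningClosedTrail H Xs Ys
  spanning-trail U U? X Y {Xs} {Ys} uX X∉Ys Xs⊆X Ys⊆Y big {u₀} {r} uu o w out =
    -- Forbidding `X` as well as `Y` makes `F` disjoint from `X`, so that `F ++ X` repeats no edge;
    -- the prescription `par H X` makes it even on the core.
    join (Core.core-collapsible U U? (X ++ Y) big r uu o w (par H X))
    where
    core? : ∀ e → Dec (∃ λ v → U v × On v e)
    core? e = Finₚ.any? (λ v → U? v ×-dec on? v e)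
    join : (∃ λ F → Unique F × (∀ {ε} → ε ∈ F → ε ∉ X ++ Y × ∃ λ v → U v × InClique v ε) ×
      (∀ {e} → (∃ λ v → U v × On v e) → e ≢ r → par H F e ≡ par H X e) ×
      (∀ {e} → (∃ λ v → U v × On v e) → FReach H F r e)) → SpanningClosedTrail H Xs Ys
    join (F , uF , pF , parF , conF) = even-connected⇒trail H (F ++ X) r
      (Uniqueₚ.++⁺ uF uX (λ (a , b) → proj₁ (pF a) (∈-++⁺ˡ b))) avoids
      (λ ε x → ∈-++⁺ʳ F (Xs⊆X ε x)) parity conn
      where
      avoids : ∀ {ε} → ε ∈ F ++ X → ε Subset.∉ Ys
      avoids q y with ∈-++⁻ F q
      ... | inj₁ a = proj₁ (pF a) (∈-++⁺ʳ X (Ys⊆Y y))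
      ... | inj₂ b = X∉Ys b y
      parity : ∀ e → e ≢ r → par H (F ++ X) e ≡ false
      parity e e≢r with core? e
      ... | yes c = trans (par-++ H F X e) (trans (cong (_xor par H X e) (parF c e≢r)) (xor-same (par H X e)))
      ... | no ¬c = trans (par-++ H F X e) (cong₂ _xor_
        (par-∉ H F e (λ q i → let v , uv , k = proj₂ (pF q) in ¬c (v , uv , inClique-end k i))) (proj₁ (out e ¬c)))
      conn : ∀ e → FReach H (F ++ X) r e
      conn e with core? e
      ... | yes c = freach-mono H ∈-++⁺ˡ (conF c)
      ... | no ¬c = let f , c , p = proj₂ (out e ¬c) in
        freach-trans H (freach-mono H ∈-++⁺ˡ (conF c)) (freach-mono H (∈-++⁺ʳ F) p)

  supereulerian-of-large-cliques : ∀ s t → (∀ v → s + t + 3 ≤ d v) → ∀ {u₀ r} → On u₀ r →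
    (∀ v → Within _~_ (λ _ → ⊤) u₀ v) → (∀ e → ∃ λ v → On v e) → Supereulerian s t H
  supereulerian-of-large-cliques s t large o w covers Xs Ys disj lX lY =
    spanning-trail (λ _ → ⊤) (λ _ → yes tt) (elements Xs) (elements Ys) (elements-unique Xs)
      (λ q → disj _ (∈-elements⁻ Xs q)) (λ _ → ∈-elements⁺ Xs) (∈-elements⁺ Ys)
      (λ {v} _ → ℕₚ.≤-trans (ℕₚ.+-monoˡ-≤ 3 (count v)) (large v)) tt o (λ _ → w _)
      (λ e ¬c → let v , k = covers e in ⊥-elim (¬c (v , tt , k)))
    where
    count : ∀ v → length (filter (inClique? v) (elements Xs ++ elements Ys)) ≤ s + t
    count v = ℕₚ.≤-trans (length-filter (inClique? v) (elements Xs ++ elements Ys))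
      (subst (_≤ s + t) (sym (trans (length-++ (elements Xs)) (cong₂ _+_ (length-elements Xs) (length-elements Ys))))
        (ℕₚ.+-mono-≤ lX lY))

  -- All edges outside the cliques in U are traversed; they form paths and cycles through vertices of degree 2.
  supereulerian-of-linked-core : (U : Fin N → Set) → (∀ v → Dec (U v)) → (∀ {v} → U v → 3 ≤ d v) →
    ∀ {u₀ r} → U u₀ → On u₀ r → (∀ {v} → U v → Within _~_ U u₀ v) → (∀ e f → Reach H e f) →
    (∀ e → ¬ (∃ λ v → U v × On v e) → deg H e ≡ 2) → Supereulerian 0 0 H
  supereulerian-of-linked-core U U? big {u₀} {r} uu o w con two Xs Ys disj lX lY =
    spanning-trail U U? X [] (Uniqueₚ.filter⁺ outside? (Uniqueₚ.allFin⁺ _))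
      (λ _ y → empty Ys lY y) (λ _ x → ⊥-elim (empty Xs lX x)) (λ y → ⊥-elim (empty Ys lY y))
      -- No edge of `X` lies in a clique of the core, so these cliques lose nothing and size 3 is
      -- enough.
      (λ {v} uv → subst (λ l → length l + 3 ≤ d v) (sym (none uv)) (big uv)) uu o w
      (λ e ¬c → parity e ¬c , attach (con e r) ¬c)
    where
    Core : V H → Set
    Core e = ∃ λ v → U v × On v e
    core? : ∀ e → Dec (Core e)
    core? e = Finₚ.any? (λ v → U? v ×-dec on? v e)
    outside? : ∀ ε → Dec (¬ (∃ λ v → U v × InClique v ε))
    outside? ε = ¬? (Finₚ.any? (λ v → U? v ×-dec inClique? v ε))
    X : List (Ed H)
    X = filter outside? (allFin (m H))
    empty : ∀ {k} (S : Subset.Subset k) → Subset.∣ S ∣ ≤ 0 → ∀ {x} → x Subset.∈ S → ⊥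
    empty S l x with elements S | length-elements S | ∈-elements⁺ S x
    ... | _ ∷ _ | eq | _ = ℕₚ.<⇒≱ (s≤s z≤n) (subst (_≤ 0) (sym eq) l)
    none : ∀ {v} → U v → filter (inClique? v) (X ++ []) ≡ []
    none {v} uv = filter-none (inClique? v) (All.tabulate (λ q k → absurd k (∈-++⁻ X q)))
      where
      absurd : ∀ {ε} → InClique v ε → ε ∈ X ⊎ ε ∈ [] → ⊥
      absurd k (inj₁ q) = proj₂ (∈-filter⁻ outside? {xs = allFin (m H)} q) (v , uv , k)
    outer : ∀ {e ε} → ¬ Core e → Incident H e ε → ε ∈ X
    outer ¬c i = ∈-filter⁺ outside? (∈-allFin _) (λ (v , uv , k) → ¬c (v , uv , inClique-end k i))
    -- Both edges at an outer vertex belong to `X`, since a core clique containing either would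
    -- contain the vertex. With degree 2 the parity is even.
    parity : ∀ e → ¬ Core e → par H X e ≡ false
    parity e ¬c with star H e
    ... | es , u , l , to , from = by-pair es u (trans l (two e ¬c)) to from
      where
      by-pair : ∀ es → Unique es → length es ≡ 2 → (∀ {ε} → ε ∈ es → Incident H e ε) → (∀ {ε} → Incident H e ε → ε ∈ es) →
        par H X e ≡ false
      by-pair (ε₁ ∷ ε₂ ∷ []) ((ε₁≢ε₂ ∷ []) ∷ _) refl to from = strip (∈⇒↭∷ (outer ¬c (to (here refl))))
        where
        inc-true : ∀ {ε} → Incident H e ε → inc H ε e ≡ true
        inc-true i = inc-end H (proj₂ (incident⇒joins H i))
        strip : (∃ λ X₁ → X ↭ ε₁ ∷ X₁) → par H X e ≡ false
        strip (X₁ , p) = strip₂ (∈⇒↭∷ ε₂∈)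
          where
          ε₂∈ : ε₂ ∈ X₁
          ε₂∈ with ∈-resp-↭ p (outer ¬c (to (there (here refl))))
          ... | here q = ⊥-elim (ε₁≢ε₂ (sym q))
          ... | there q = q
          strip₂ : (∃ λ X₂ → X₁ ↭ ε₂ ∷ X₂) → par H X e ≡ false
          strip₂ (X₂ , q) = trans (par-↭ H all e)
            (cong₂ _xor_ (inc-true (to (here refl))) (cong₂ _xor_ (inc-true (to (there (here refl)))) (par-∉ H X₂ e rest)))
            where
            all : X ↭ ε₁ ∷ ε₂ ∷ X₂
            all = ↭-trans p (prep ε₁ q)
            rest : ∀ {ε} → ε ∈ X₂ → ¬ Incident H e ε
            rest z i with unique-resp-↭ all (Uniqueₚ.filter⁺ outside? (Uniqueₚ.allFin⁺ _)) | from i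
            ... | (_ ∷ a) ∷ _ | here refl = All.lookup a z refl
            ... | _ ∷ b ∷ _ | there (here refl) = All.lookup b z refl
    -- On a path towards `r`, every edge up to the first core vertex has an outer end and therefore
    -- lies in `X`.
    attach : ∀ {e} → Reach H e r → ¬ Core e → ∃ λ f → Core f × FReach H X f e
    attach here ¬c = ⊥-elim (¬c (u₀ , uu , o))
    attach (step {v = e′} a p) ¬c = via (edge H a) (core? e′)
      where
      via : (∃ λ ε → Joins H ε _ e′) → Dec (Core e′) → ∃ λ f → Core f × FReach H X f _
      via (ε , j) (yes c) = e′ , c , step (outer ¬c (joins⇒incidentˡ H j)) (joins-sym H j) here
      via (ε , j) (no ¬c′) = let f , c , q = attach p ¬c′ in
        f , c , freach-trans H q (step (outer ¬c (joins⇒incidentˡ H j)) (joins-sym H j) here)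

-- Line graphs of graphs with large minimum degree

module LineCliques (G : Graph) = CliquePartition (L G) (n G) (deg G) (Incident G) (incident? G)
  (L-adj⁺ G) (common-vertex-unique G) (star-at G) (Adj G)
  (adj⇒common-edge G)

module _ (G : Graph) where

  adj⇒0<deg : ∀ {u v} → Adj G u v → 1 ≤ deg G u
  adj⇒0<deg a = length≤deg G {xs = _ ∷ []} ([] ∷ []) (λ { (here refl) → a })

  0<deg⇒incident : ∀ {v} → 0 < deg G v → ∃ λ e → Incident G v e
  0<deg⇒incident {v} p with nbrs G v in eq
  ... | [] = ⊥-elim (ℕₚ.<⇒≱ p (ℕₚ.≤-reflexive (trans (deg≡length-nbrs G v) (cong length eq))))
  ... | w ∷ ws = let e , j = edge G (∈-nbrs⁻ G (subst (w ∈_) (sym eq) (here refl))) in e , joins⇒incidentˡ G j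

  deg-1⇒unique : ∀ {a x y} → deg G a ≡ 1 → Adj G a x → Adj G a y → x ≡ y
  deg-1⇒unique {a} {x} {y} d ax ay with x ≟ y
  ... | yes p = p
  ... | no x≢y = ⊥-elim (ℕₚ.<⇒≱ (ℕₚ.n<1+n 1) (subst (2 ≤_) d
    (length≤deg G {xs = x ∷ y ∷ []} ((x≢y ∷ []) ∷ [] ∷ []) (λ { (here refl) → ax ; (there (here refl)) → ay }))))

  reach⇒within : ∀ {u v} → Reach G u v → Within (Adj G) (λ _ → ⊤) u v
  reach⇒within here = here
  reach⇒within (step a r) = step a tt (reach⇒within r)

large-minDeg⇒supereulerian : ∀ G s t → (∀ u v → Reach G u v) → s + t + 3 ≤ minDeg G → Supereulerian s t (L G)
large-minDeg⇒supereulerian G s t con large =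
  LineCliques.supereulerian-of-large-cliques G s t (λ v → ℕₚ.≤-trans large (minDeg≤deg G v))
    (proj₂ (0<deg⇒incident G {u₀} (ℕₚ.≤-trans pos (minDeg≤deg G u₀)))) (λ v → reach⇒within G (con u₀ v))
    (λ e → proj₁ (ends G e) , inj₁ refl)
  where
  pos : 0 < minDeg G
  pos = ℕₚ.≤-trans (ℕₚ.≤-trans (s≤s z≤n) (ℕₚ.m≤n+m 3 (s + t))) large
  u₀ : V G
  u₀ = Fin.fromℕ< (0<minDeg⇒0<n G pos)

0<m : ∀ G → 0 < minDeg G → 0 < m G
0<m G pos = ℕₚ.≤-trans (s≤s z≤n) (Finₚ.toℕ<n (proj₁ (0<deg⇒incident G {u₀} (ℕₚ.≤-trans pos (minDeg≤deg G u₀)))))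
  where
  u₀ : V G
  u₀ = Fin.fromℕ< (0<minDeg⇒0<n G pos)

minDeg-L : ∀ G b → 2 + b ≤ minDeg G → 2 + b * 2 ≤ minDeg (L G)
minDeg-L G b l = ≤minDeg (L G) (0<m G (ℕₚ.≤-trans (s≤s z≤n) l)) (λ e → ℕₚ.+-cancelˡ-≤ 2 _ _
  (subst₂ _≤_ lem (deg-L G (ends-joins G e)) (ℕₚ.+-mono-≤ (ℕₚ.≤-trans l (minDeg≤deg G _)) (ℕₚ.≤-trans l (minDeg≤deg G _)))))
  where
  lem : (2 + b) + (2 + b) ≡ 2 + (2 + b * 2)
  lem = solve 1 (λ b → (con 2 :+ b) :+ (con 2 :+ b) := con 2 :+ (con 2 :+ b :* con 2)) refl b
    where open +-*-Solver

minDeg-L^ : ∀ G b k → 2 + b ≤ minDeg G → 2 + b * 2 ^ k ≤ minDeg (L^ k G)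
minDeg-L^ G b zero l = subst (λ x → 2 + x ≤ minDeg G) (sym (ℕₚ.*-identityʳ b)) l
minDeg-L^ G b (suc k) l = subst (λ x → 2 + x ≤ minDeg (L^ (suc k) G))
  (trans (ℕₚ.*-assoc b (2 ^ k) 2) (cong (b *_) (ℕₚ.*-comm (2 ^ k) 2))) (minDeg-L (L^ k G) (b * 2 ^ k) (minDeg-L^ G b k l))

L^-connected : ∀ k G → (∀ u v → Reach G u v) → ∀ u v → Reach (L^ k G) u v
L^-connected zero G con = con
L^-connected (suc k) G con = L-connected (L^ k G) (L^-connected k G con)

-- After `k` rounds the minimum degree is at least `2 + b * 2 ^ k`, hence at least `s + t + 3`; the
-- extra round is the line graph whose cliques are merged.
iterate⇒supereulerian : ∀ G s t b k → (∀ u v → Reach G u v) → 2 + b ≤ minDeg G → s + t + 1 ≤ b * 2 ^ k →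
  Supereulerian s t (L^ (suc k) G)
iterate⇒supereulerian G s t b k con l h = large-minDeg⇒supereulerian (L^ k G) s t (L^-connected k G con)
  (ℕₚ.≤-trans (subst (_≤ 2 + b * 2 ^ k) lem (ℕₚ.+-monoʳ-≤ 2 h)) (minDeg-L^ G b k l))
  where
  lem : 2 + (s + t + 1) ≡ s + t + 3
  lem = trans (ℕₚ.+-comm 2 (s + t + 1)) (ℕₚ.+-assoc (s + t) 1 2)

L^-+ : ∀ i j G → L^ i (L^ j G) ≡ L^ (i + j) G
L^-+ zero j G = refl
L^-+ (suc i) j G = cong L (L^-+ i j G)

-- Strong induction from `⌈ k /2⌉` to `k`: halving lowers the logarithm by one, and `k` is at most
-- twice its upper half.
n≤2^⌈log₂n⌉ : ∀ k → k ≤ 2 ^ ⌈log₂ k ⌉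
n≤2^⌈log₂n⌉ = <-rec _ go
  where
  go : ∀ k → (∀ {j} → j < k → j ≤ 2 ^ ⌈log₂ j ⌉) → k ≤ 2 ^ ⌈log₂ k ⌉
  go zero _ = z≤n
  go (suc zero) _ = ℕₚ.m^n>0 2 ⌈log₂ 1 ⌉
  go k@(suc (suc j)) rec = ℕₚ.≤-trans k≤ (ℕₚ.≤-trans (ℕₚ.+-mono-≤ ih ih) (ℕₚ.≤-reflexive double))
    where
    h = ℕ.⌈ k /2⌉
    k≤ : k ≤ h + h
    k≤ = ℕₚ.≤-trans (ℕₚ.≤-reflexive (sym (ℕₚ.⌊n/2⌋+⌈n/2⌉≡n k))) (ℕₚ.+-monoˡ-≤ h (ℕₚ.⌊n/2⌋≤⌈n/2⌉ k))
    c = ⌈log₂ k ⌉ ∸ 1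
    ih : h ≤ 2 ^ c
    ih = subst (λ x → h ≤ 2 ^ x) (⌈log₂⌈n/2⌉⌉≡⌈log₂n⌉∸1 k) (rec (ℕₚ.⌈n/2⌉<n j))
    -- Here `k` is at least 2, so its logarithm is at least 1 and the subtraction in `c` is not
    -- truncated.
    double : 2 ^ c + 2 ^ c ≡ 2 ^ ⌈log₂ k ⌉
    double = trans (cong (2 ^ c +_) (sym (ℕₚ.+-identityʳ (2 ^ c))))
      (cong (2 ^_) (ℕₚ.m+[n∸m]≡n (⌈log₂⌉-mono-≤ {2} {k} (s≤s (s≤s z≤n)))))

-- Branches and their behaviour under the line graph operation

-- Repeated vertices and equal ends are allowed, so that lifting to the line graph needs no record
-- of distinctness.
data Divalent (G : Graph) : ℕ → V G → V G → Set where
  one  : ∀ {u v} → Adj G u v → Divalent G 1 u v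
  cons : ∀ {k u x v} → Adj G u x → deg G x ≡ 2 → Divalent G k x v → Divalent G (suc k) u v

data Linked (G : Graph) (l : ℕ) : V G → V G → Set where
  here : ∀ {u} → Linked G l u u
  step : ∀ {k u x w} → 3 ≤ deg G x → k ≤ l → Divalent G k u x → Linked G l x w → Linked G l u w

record Branched (l : ℕ) (G : Graph) : Set where
  field
    connected : ∀ u v → Reach G u v
    linked    : ∀ {u w} → 3 ≤ deg G u → 3 ≤ deg G w → Linked G l u w
    pendant   : ∀ {p} → deg G p ≡ 1 → ∃ λ k → ∃ λ u → k ≤ l × 3 ≤ deg G u × Divalent G k p u
    -- Makes (u, v) a vertex of degree at least 3 in L(G), and its existence passes on to L(G).
    heavy     : ∃ λ u → ∃ λ v → Adj G u v × 3 ≤ deg G u × 5 ≤ deg G u + deg G v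

open Branched

linked-trans : ∀ {G l u v w} → Linked G l u v → Linked G l v w → Linked G l u w
linked-trans here q = q
linked-trans (step d k p r) q = step d k p (linked-trans r q)

divalent-pos : ∀ {G k u v} → Divalent G k u v → 1 ≤ k
divalent-pos (one _) = s≤s z≤n
divalent-pos (cons _ _ _) = s≤s z≤n

module _ (G : Graph) where

  L-deg≥ : ∀ {e u v} c → Joins G e u v → 2 + c ≤ deg G u + deg G v → c ≤ deg (L G) e
  L-deg≥ c j l = ℕₚ.+-cancelˡ-≤ 2 _ _ (subst (2 + c ≤_) (deg-L G j) l)

  L-deg-2 : ∀ {e u v} → Joins G e u v → deg G u ≡ 2 → deg G v ≡ 2 → deg (L G) e ≡ 2
  L-deg-2 j p q = ℕₚ.+-cancelˡ-≡ 2 _ _ (trans (sym (deg-L G j)) (cong₂ _+_ p q))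

  -- Equality stands for the walk of length 0, which `Divalent` lacks. It arises when a walk in `G`
  -- turns back along the edge just used.
  LStep : ℕ → Ed G → Ed G → Set
  LStep k e f = (e ≡ f) ⊎ (∃ λ k′ → k′ ≤ k × Divalent (L G) k′ e f)

  lstep-cons : ∀ {k e f g v} → Incident G v e → Incident G v f → deg (L G) f ≡ 2 → LStep k f g → LStep (suc k) e g
  lstep-cons {e = e} {f} i j d s with e ≟ f
  lstep-cons i j d (inj₁ p) | yes refl = inj₁ p
  lstep-cons i j d (inj₂ (k′ , l , w)) | yes refl = inj₂ (k′ , ℕₚ.m≤n⇒m≤1+n l , w)
  lstep-cons i j d (inj₁ refl) | no e≢f = inj₂ (1 , s≤s z≤n , one (L-adj⁺ G e≢f i j))
  lstep-cons i j d (inj₂ (k′ , l , w)) | no e≢f = inj₂ (suc k′ , s≤s l , cons (L-adj⁺ G e≢f i j) d w)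

  lstep-near : ∀ {l e f v} → 1 ≤ l → Incident G v e → Incident G v f → LStep l e f
  lstep-near {e = e} {f} 1≤l i j with e ≟ f
  ... | yes p = inj₁ p
  ... | no e≢f = inj₂ (1 , 1≤l , one (L-adj⁺ G e≢f i j))

  -- The source of the shortening: `e` followed by the given walk has `k + 1` edges, hence at most
  -- `k` steps between consecutive ones. The edges strictly in between have both ends of degree 2,
  -- so their degree in `L G` is 2.
  lift-divalent : ∀ {k e u x v} → Joins G e u x → deg G x ≡ 2 → Divalent G k x v →
    ∃ λ f → ∃ λ y → Joins G f y v × deg G y ≡ 2 × LStep k e f
  lift-divalent {x = x} j d (one a) =
    let f , jf = edge G a in f , x , jf , d , lstep-near (s≤s z≤n) (joins⇒incidentʳ G j) (joins⇒incidentˡ G jf)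
  lift-divalent j d (cons a d′ w) =
    let e′ , j′ = edge G a
        f , y , jf , dy , s = lift-divalent j′ d′ w
    in f , y , jf , dy , lstep-cons (joins⇒incidentʳ G j) (joins⇒incidentˡ G j′) (L-deg-2 j′ d d′) s

  linked-lstep : ∀ {l e f} → 3 ≤ deg (L G) f → LStep l e f → Linked (L G) l e f
  linked-lstep d (inj₁ refl) = here
  linked-lstep d (inj₂ (k , k≤l , w)) = step d k≤l w here

  -- The first and last edges of a hop of length at least 2 join degree at least 3 to degree 2, so
  -- they have degree at least 3 in `L G` and become stops; a hop of length 1 becomes a single stop.
  -- Edges at a common stop of `G` are at most one step apart, whence `1 ≤ l`.
  lift-linked : ∀ {l u w} → 1 ≤ l → 3 ≤ deg G u → Linked G (suc l) u w → ∀ {e f} → Incident G u e → Incident G w f →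
    3 ≤ deg (L G) e → 3 ≤ deg (L G) f → Linked (L G) l e f
  lift-linked 1≤l du here i j de df = linked-lstep df (lstep-near 1≤l i j)
  lift-linked 1≤l du (step dx k≤ (one a) r) i j de df =
    let g , jg = edge G a
        dg = L-deg≥ 3 jg (ℕₚ.≤-trans (ℕₚ.m≤m+n 5 1) (ℕₚ.+-mono-≤ du dx))
    in linked-trans (linked-lstep dg (lstep-near 1≤l i (joins⇒incidentˡ G jg)))
         (lift-linked 1≤l dx r (joins⇒incidentʳ G jg) j dg df)
  lift-linked 1≤l du (step dx (s≤s k≤) (cons a d w) r) i j de df =
    let g , jg = edge G a
        dg = L-deg≥ 3 jg (ℕₚ.+-mono-≤ du (ℕₚ.≤-reflexive (sym d)))
        h , y , jh , dy , s = lift-divalent jg d w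
        dh = L-deg≥ 3 jh (ℕₚ.+-mono-≤ (ℕₚ.≤-reflexive (sym dy)) dx)
    in linked-trans (linked-lstep dg (lstep-near 1≤l i (joins⇒incidentˡ G jg)))
         (linked-trans (linked-lstep dh (weaken k≤ s)) (lift-linked 1≤l dx r (joins⇒incidentʳ G jh) j dh df))
    where
    weaken : ∀ {k l e f} → k ≤ l → LStep k e f → LStep l e f
    weaken k≤l (inj₁ p) = inj₁ p
    weaken k≤l (inj₂ (k′ , p , w)) = inj₂ (k′ , ℕₚ.≤-trans p k≤l , w)

  -- Two ends of degree at most 2 would give `e` degree at most 2 in `L G`.
  big-end : ∀ e → 3 ≤ deg (L G) e → ∃ λ v → Incident G v e × 3 ≤ deg G v
  big-end e d with 3 ℕ.≤? deg G (proj₁ (ends G e)) | 3 ℕ.≤? deg G (proj₂ (ends G e))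
  ... | yes p | _ = _ , inj₁ refl , p
  ... | no _ | yes q = _ , inj₂ refl , q
  ... | no p | no q = ⊥-elim (ℕₚ.<⇒≱ (s≤s (ℕₚ.+-mono-≤ (ℕₚ.≤-pred (ℕₚ.≰⇒> p)) (ℕₚ.≤-pred (ℕₚ.≰⇒> q))))
    (subst (5 ≤_) (sym (deg-L G (ends-joins G e))) (ℕₚ.+-monoʳ-≤ 2 d)))

  L-linked : ∀ {l} → 1 ≤ l → Branched (suc l) G → ∀ {e f} → 3 ≤ deg (L G) e → 3 ≤ deg (L G) f → Linked (L G) l e f
  L-linked 1≤l b {e} {f} de df =
    let u , i , du = big-end e de
        w , j , dw = big-end f df
    in lift-linked 1≤l du (linked b du dw) i j de df

  pendant-split : ∀ {e} → deg (L G) e ≡ 1 → ∃ λ p → ∃ λ q → Joins G e p q × deg G p ≡ 1 × deg G q ≡ 2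
  pendant-split {e} d = split (adj⇒0<deg G a) (adj⇒0<deg G (adj-sym G a)) (trans (deg-L G (ends-joins G e)) (cong (2 +_) d))
    where
    a = ends-adj G e
    p = proj₁ (ends G e)
    q = proj₂ (ends G e)
    split : 1 ≤ deg G p → 1 ≤ deg G q → deg G p + deg G q ≡ 3 → ∃ λ p → ∃ λ q → Joins G e p q × deg G p ≡ 1 × deg G q ≡ 2
    split dp dq s with deg G p in ep | deg G q in eq
    split dp dq refl | 1 | 2 = p , q , inj₁ refl , ep , eq
    split dp dq refl | 2 | 1 = q , p , inj₂ refl , eq , ep
    split dp () refl | 3 | 0

  -- A vertex of degree 1 in `L G` is an edge from some `p` of degree 1 to some `q` of degree 2. The
  -- walk from `p` to a branch vertex must begin with this edge and cannot end at `q`, so it lifts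
  -- with one step fewer.
  L-pendant : ∀ {l} → Branched (suc l) G → ∀ {e} → deg (L G) e ≡ 1 → ∃ λ k → ∃ λ f → k ≤ l × 3 ≤ deg (L G) f × Divalent (L G) k e f
  L-pendant {l} b {e} d = go (pendant-split d)
    where
    walk : ∀ {p q} → Joins G e p q → deg G p ≡ 1 → deg G q ≡ 2 → (∃ λ k → ∃ λ u → k ≤ suc l × 3 ≤ deg G u × Divalent G k p u) →
      ∃ λ k → ∃ λ f → k ≤ l × 3 ≤ deg (L G) f × Divalent (L G) k e f
    walk j dp dq (_ , u , _ , du , one a) = ⊥-elim (ℕₚ.<⇒≱ du (ℕₚ.≤-reflexive
      (trans (cong (deg G) (deg-1⇒unique G dp a (joins⇒adj G j))) dq)))
    walk j dp dq (suc k , u , s≤s k≤ , du , cons a dx w) with deg-1⇒unique G dp a (joins⇒adj G j)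
    ... | refl = let f , y , jf , dy , s = lift-divalent j dx w in
      close (L-deg≥ 3 jf (ℕₚ.+-mono-≤ (ℕₚ.≤-reflexive (sym dy)) du)) s
      where
      close : ∀ {f} → 3 ≤ deg (L G) f → LStep k e f → ∃ λ k → ∃ λ f → k ≤ l × 3 ≤ deg (L G) f × Divalent (L G) k e f
      close df (inj₁ refl) = ⊥-elim (ℕₚ.<⇒≱ df (ℕₚ.≤-trans (ℕₚ.≤-reflexive d) (s≤s z≤n)))
      close {f} df (inj₂ (k′ , k′≤ , w)) = k′ , f , ℕₚ.≤-trans k′≤ k≤ , df , w
    go : (∃ λ p → ∃ λ q → Joins G e p q × deg G p ≡ 1 × deg G q ≡ 2) → ∃ λ k → ∃ λ f → k ≤ l × 3 ≤ deg (L G) f × Divalent (L G) k e f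
    go (p , q , j , dp , dq) = walk j dp dq (pendant b dp)

  -- A heavy edge `e` at `u` has degree at least 3 in `L G`. There are further edges `f` and `g` at
  -- `u`, and `f` is adjacent to both `e` and `g`, so the degrees of `e` and `f` sum to at least 5.
  L-heavy : ∀ {l} → Branched l G → ∃ λ e → ∃ λ f → Adj (L G) e f × 3 ≤ deg (L G) e × 5 ≤ deg (L G) e + deg (L G) f
  L-heavy b with heavy b
  ... | u , v , a , du , duv = let e , j = edge G a in others e j (star-at G (joins⇒incidentˡ G j))
    where
    others : ∀ e → Joins G e u v → (∃ λ es → Unique (e ∷ es) × suc (length es) ≡ deg G u ×
      (∀ {f} → f ∈ e ∷ es → Incident G u f) × (∀ {f} → Incident G u f → f ∈ e ∷ es)) →
      ∃ λ e → ∃ λ f → Adj (L G) e f × 3 ≤ deg (L G) e × 5 ≤ deg (L G) e + deg (L G) f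
    others e j ([] , _ , l , _) = ⊥-elim (ℕₚ.<⇒≱ du (subst (_≤ 2) l (s≤s z≤n)))
    others e j (_ ∷ [] , _ , l , _) = ⊥-elim (ℕₚ.<⇒≱ du (subst (_≤ 2) l (s≤s (s≤s z≤n))))
    others e j (f ∷ g ∷ es , (e≢f ∷ e≢g ∷ _) ∷ (f≢g ∷ _) ∷ _ , l , to , _) =
      e , f , L-adj⁺ G e≢f ie if , de , ℕₚ.+-mono-≤ de
        (length≤deg (L G) {xs = e ∷ g ∷ []} ((e≢g ∷ []) ∷ [] ∷ [])
          (λ { (here refl) → L-adj⁺ G (≢-sym e≢f) if ie ; (there (here refl)) → L-adj⁺ G f≢g if (to (there (there (here refl)))) }))
      where
      ie = to (here refl)
      if = to (there (here refl))
      de = L-deg≥ 3 j duv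

  L-branched : ∀ {l} → 1 ≤ l → Branched (suc l) G → Branched l (L G)
  L-branched 1≤l b = record
    { connected = L-connected G (connected b) ; linked = L-linked 1≤l b ; pendant = L-pendant b ; heavy = L-heavy b }

  -- An edge outside the core has no end of degree 1, as the neighbour of such an end would have
  -- degree at least 3. Both ends thus have degree 2, and so does the edge in `L G`.
  branched₁⇒supereulerian : Branched 1 G → Supereulerian 0 0 (L G)
  branched₁⇒supereulerian b = let u₀ , v₀ , a₀ , du₀ , _ = heavy b in LineCliques.supereulerian-of-linked-core G (λ v → 3 ≤ deg G v) (λ v → 3 ℕ.≤? deg G v) id
    du₀ (joins⇒incidentˡ G (proj₂ (edge G a₀))) (λ d → within (linked b du₀ d)) (L-connected G (connected b)) two
    where
    within : ∀ {u v} → Linked G 1 u v → Within (Adj G) (λ v → 3 ≤ deg G v) u v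
    within here = here
    within (step d _ (one a) r) = step a d (within r)
    within (step d (s≤s k≤0) (cons a _ w) r) = ⊥-elim (ℕₚ.<⇒≱ (divalent-pos w) k≤0)
    end-2 : ∀ {p q} → Adj G p q → ¬ (3 ≤ deg G p) → ¬ (3 ≤ deg G q) → deg G p ≡ 2
    end-2 {p} {q} a ¬p ¬q with deg G p in eq
    ... | 0 = ⊥-elim (ℕₚ.<⇒≱ (adj⇒0<deg G a) (ℕₚ.≤-reflexive eq))
    ... | 2 = refl
    ... | suc (suc (suc _)) = ⊥-elim (¬p (s≤s (s≤s (s≤s z≤n))))
    ... | 1 = ⊥-elim (near (pendant b eq))
      where
      near : (∃ λ k → ∃ λ u → k ≤ 1 × 3 ≤ deg G u × Divalent G k p u) → ⊥
      near (_ , u , _ , du , one a′) = ¬q (subst (λ x → 3 ≤ deg G x) (deg-1⇒unique G eq a′ a) du)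
      near (_ , u , s≤s k≤0 , du , cons _ _ w) = ℕₚ.<⇒≱ (divalent-pos w) k≤0
    two : ∀ e → ¬ (∃ λ v → 3 ≤ deg G v × Incident G v e) → deg (L G) e ≡ 2
    two e ¬c = L-deg-2 (ends-joins G e) (end-2 a (λ d → ¬c (_ , d , inj₁ refl)) (λ d → ¬c (_ , d , inj₂ refl)))
      (end-2 (adj-sym G a) (λ d → ¬c (_ , d , inj₂ refl)) (λ d → ¬c (_ , d , inj₁ refl)))
      where a = ends-adj G e

supereulerian-resp-≡ : ∀ {s t} G H → G ≡ H → Supereulerian s t G → Supereulerian s t H
supereulerian-resp-≡ G .G refl p = p

branched⇒supereulerian : ∀ l G → Branched (suc l) G → Supereulerian 0 0 (L^ (suc l) G)
branched⇒supereulerian zero G b = branched₁⇒supereulerian G b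
-- `L^` puts each new `L` outermost, while the induction peels off the innermost one; hence the
-- transport.
branched⇒supereulerian (suc l) G b = supereulerian-resp-≡ (L^ (suc l) (L G)) (L^ (suc (suc l)) G)
  (trans (L^-+ (suc l) 1 G) (cong (λ k → L^ k G) (ℕₚ.+-comm (suc l) 1)))
  (branched⇒supereulerian l (L G) (L-branched G (s≤s z≤n) b))

-- Cutting simple paths into divalent paths

module _ (G : Graph) where

  data SimplePath : V G → V G → List (V G) → Set where
    end  : ∀ {u} → SimplePath u u (u ∷ [])
    cons : ∀ {u x v xs} → Adj G u x → u ∉ xs → SimplePath x v xs → SimplePath u v (u ∷ xs)

  start∈ : ∀ {u v xs} → SimplePath u v xs → u ∈ xs
  start∈ end = here refl
  start∈ (cons _ _ _) = here refl

  suffix : ∀ {u x v xs} → u ∈ xs → SimplePath x v xs → ∃ λ ys → SimplePath u v ys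
  suffix (here refl) end = _ , end
  suffix (here refl) p@(cons _ _ _) = _ , p
  suffix (there q) (cons _ _ p) = suffix q p

  reach⇒path : ∀ {u v} → Reach G u v → ∃ λ xs → SimplePath u v xs
  reach⇒path here = _ , end
  reach⇒path (step {u} a r) with reach⇒path r
  ... | xs , p with Any.any? (u ≟_) xs
  ... | yes u∈ = suffix u∈ p
  ... | no u∉ = _ , cons a u∉ p

  -- Unlike `Divalent`, this records distinctness, because ℓ(G) bounds only genuine paths.
  data Segment : ℕ → V G → V G → List (V G) → Set where
    one  : ∀ {u v} → Adj G u v → Segment 1 u v (u ∷ v ∷ [])
    cons : ∀ {k u x v xs} → Adj G u x → deg G x ≡ 2 → u ∉ xs → Segment k x v xs → Segment (suc k) u v (u ∷ xs)

  segment⇒divalent : ∀ {k u v xs} → Segment k u v xs → Divalent G k u v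
  segment⇒divalent (one a) = one a
  segment⇒divalent (cons a d _ s) = cons a d (segment⇒divalent s)

  vertex : ∀ {k u v xs} → Segment k u v xs → Fin (suc k) → V G
  vertex {u = u} s zero = u
  vertex {v = v} (one _) (suc zero) = v
  vertex (cons _ _ _ s) (suc i) = vertex s i

  vertex∈ : ∀ {k u v xs} (s : Segment k u v xs) i → vertex s i ∈ xs
  vertex∈ (one _) zero = here refl
  vertex∈ (one _) (suc zero) = there (here refl)
  vertex∈ (cons _ _ _ s) zero = here refl
  vertex∈ (cons _ _ _ s) (suc i) = there (vertex∈ s i)

  vertex-injective : ∀ {k u v xs} (s : Segment k u v xs) {i j} → vertex s i ≡ vertex s j → i ≡ j
  vertex-injective s {zero} {zero} _ = refl
  vertex-injective (one a) {zero} {suc zero} e = ⊥-elim (adj⇒≢ G a e)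
  vertex-injective (one a) {suc zero} {zero} e = ⊥-elim (adj⇒≢ G a (sym e))
  vertex-injective (one a) {suc zero} {suc zero} _ = refl
  vertex-injective (cons _ _ u∉ s) {zero} {suc j} e = ⊥-elim (u∉ (subst (_∈ _) (sym e) (vertex∈ s j)))
  vertex-injective (cons _ _ u∉ s) {suc i} {zero} e = ⊥-elim (u∉ (subst (_∈ _) e (vertex∈ s i)))
  vertex-injective (cons _ _ _ s) {suc i} {suc j} e = cong suc (vertex-injective s e)

  vertex-last : ∀ {k u v xs} (s : Segment k u v xs) → vertex s (fromℕ k) ≡ v
  vertex-last (one _) = refl
  vertex-last (cons _ _ _ s) = vertex-last s

  vertex-adjacent : ∀ {k u v xs} (s : Segment k u v xs) (i : Fin k) → Adj G (vertex s (inject₁ i)) (vertex s (suc i))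
  vertex-adjacent (one a) zero = a
  vertex-adjacent (cons a _ _ s) zero = a
  vertex-adjacent (cons _ _ _ s) (suc i) = vertex-adjacent s i

  vertex-internal : ∀ {k u v xs} (s : Segment k u v xs) i → 0 < toℕ i → toℕ i < k → deg G (vertex s i) ≡ 2
  vertex-internal (one _) (suc zero) _ (s≤s ())
  vertex-internal (cons _ d _ s) (suc zero) _ _ = d
  vertex-internal (cons _ _ _ s) (suc (suc i)) _ (s≤s l) = vertex-internal s (suc i) (s≤s z≤n) l

  segment⇒path : ∀ {k u v xs} → Segment k u v xs → DivalentPath G k
  segment⇒path s = record
    { vtx = vertex s ; distinct = vertex-injective s ; adjacent = vertex-adjacent s ; internal = vertex-internal s }

  module _ {l} (ell : IsEll G l) where

    adj⇒1≤ell : ∀ {u v} → Adj G u v → 1 ≤ l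
    adj⇒1≤ell a = proj₂ ell 1 (segment⇒path (one a) , λ ())

    -- Adjacent ends allow the whole segment to be replaced by one edge; with non-adjacent ends it
    -- is proper, and ℓ(G) bounds its length.
    shorten : ∀ {k u v xs} → Segment k u v xs → ∃ λ k′ → k′ ≤ l × Divalent G k′ u v
    shorten {k} {u} {v} s with adj? G u v
    ... | yes a = 1 , adj⇒1≤ell a , one a
    ... | no ¬a = k , proj₂ ell k (segment⇒path s , λ (_ , a) →
      ¬a (subst (Adj G u) (vertex-last s) a)) , segment⇒divalent s

    -- An inner vertex of a simple path has two distinct neighbours, so its degree is 2 unless it is
    -- at least 3. In the latter case the segment found beyond it becomes a hop and a new one
    -- starts. The final inclusion of vertex lists is what shows `u` to be new when a segment is
    -- extended.
    first-segment : ∀ {u x w xs} → 3 ≤ deg G w → Adj G u x → u ∉ xs → SimplePath x w xs →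
      ∃ λ k → ∃ λ z → ∃ λ ys → Segment k u z ys × 3 ≤ deg G z × Linked G l z w × (∀ {t} → t ∈ ys → t ∈ u ∷ xs)
    first-segment dw a u∉ end = 1 , _ , _ , one a , dw , here , id
    first-segment {u} {x} dw a u∉ (cons {x = y} a′ x∉ p) with first-segment dw a′ x∉ p | 3 ℕ.≤? deg G x
    ... | k , z , ys , s , dz , r , sub | yes dx =
      let k′ , k′≤ , w = shorten s in
      1 , x , _ , one a , dx , step dz k′≤ w r , λ { (here refl) → here refl ; (there (here refl)) → there (here refl) }
    ... | k , z , ys , s , dz , r , sub | no ¬dx =
      suc k , z , u ∷ ys , cons a dx (u∉ ∘ sub) s , dz , r , λ { (here refl) → here refl ; (there q) → there (sub q) }
      where
      dx : deg G x ≡ 2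
      dx = ℕₚ.≤-antisym (ℕₚ.≤-pred (ℕₚ.≰⇒> ¬dx)) (length≤deg G {xs = u ∷ y ∷ []}
        (((λ { refl → u∉ (there (start∈ p)) }) ∷ []) ∷ [] ∷ [])
        (λ { (here refl) → adj-sym G a ; (there (here refl)) → a′ }))

    path⇒linked : ∀ {u w xs} → 3 ≤ deg G w → SimplePath u w xs → Linked G l u w
    path⇒linked dw end = here
    path⇒linked dw (cons a u∉ p) =
      let k , z , ys , s , dz , r , _ = first-segment dw a u∉ p
          k′ , k′≤ , w = shorten s
      in step dz k′≤ w r

    path⇒pendant : ∀ {p w xs} → deg G p ≡ 1 → 3 ≤ deg G w → SimplePath p w xs →
      ∃ λ k → ∃ λ u → k ≤ l × 3 ≤ deg G u × Divalent G k p u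
    path⇒pendant dp dw end = ⊥-elim (ℕₚ.<⇒≱ dw (ℕₚ.≤-trans (ℕₚ.≤-reflexive dp) (s≤s z≤n)))
    path⇒pendant dp dw (cons a p∉ p) =
      let k , z , ys , s , dz , _ , _ = first-segment dw a p∉ p
          k′ , k′≤ , w = shorten s
      in k′ , z , k′≤ , dz , w

    ell⇒branched : (∀ u v → Reach G u v) → (∃ λ u → ∃ λ v → Adj G u v × 3 ≤ deg G u × 5 ≤ deg G u + deg G v) → Branched l G
    ell⇒branched con h@(u , _ , _ , du , _) = record
      { connected = con
      ; linked = λ _ dw → path⇒linked dw (proj₂ (reach⇒path (con _ _)))
      ; pendant = λ {p} dp → path⇒pendant dp du (proj₂ (reach⇒path (con p u)))
      ; heavy = h }

-- Graphs without an edge of degree at least 3 in the line graph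

≡ᵇ-complete : ∀ {a b} → a ≡ b → (a ℕ.≡ᵇ b) ≡ true
≡ᵇ-complete e = Equivalence.to T-≡ (ℕₚ.≡⇒≡ᵇ _ _ e)

≡ᵇ-sound : ∀ a b → (a ℕ.≡ᵇ b) ≡ true → a ≡ b
≡ᵇ-sound a b p = ℕₚ.≡ᵇ⇒≡ a b (Equivalence.from T-≡ p)

∧-split : ∀ {a b} → a ∧ b ≡ true → a ≡ true × b ≡ true
∧-split {true} p = refl , p

adjB-intro : ∀ (G : Graph) {i j} → i ≢ j → E G i j ≡ true → Adj G i j
adjB-intro G {i} {j} i≢j p with i ≟ j
... | yes q = ⊥-elim (i≢j q)
... | no _ = ∨-left p

adjB-elim : ∀ (G : Graph) {i j} → Adj G i j → (E G i j ≡ true) ⊎ (E G j i ≡ true)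
adjB-elim G {i} {j} a with i ≟ j
adjB-elim G () | yes _
... | no _ = ∨-split a

-- Recognising claws, paths and cycles

module _ (G : Graph) where

  -- As `adjB` symmetrises, completeness is needed only for `i < j`; one-sided indicators such as
  -- that of `pathGraph` are thereby covered.
  iso-of-listing : ∀ {xs : List (V G)} → Unique xs → (∀ v → v ∈ xs) →
    (e : Fin (length xs) → Fin (length xs) → Bool) →
    (∀ i j → i ≢ j → e i j ≡ true → Adj G (lookup xs i) (lookup xs j)) →
    (∀ i j → i Fin.< j → Adj G (lookup xs i) (lookup xs j) → e i j ≡ true) →
    Iso G (record { n = length xs ; E = e })
  iso-of-listing {xs} u all e sound complete = mk↔ₛ′ index (lookup xs) index-lookup lookup-idx ,
    λ v w → trans (sym (cong₂ (adjB G) (lookup-idx v) (lookup-idx w))) (⇔→≡ (mk⇔ (forward _ _) (backward _ _)))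
    where
    K : Graph
    K = record { n = length xs ; E = e }
    index : V G → Fin (length xs)
    index v = Any.index (all v)
    lookup-idx : ∀ v → lookup xs (index v) ≡ v
    lookup-idx v = sym (Anyₚ.lookup-index (all v))
    index-lookup : ∀ i → index (lookup xs i) ≡ i
    index-lookup i = lookup-injective u (lookup-idx (lookup xs i))
    forward : ∀ i j → Adj G (lookup xs i) (lookup xs j) → Adj K i j
    forward i j a with Finₚ.<-cmp i j
    ... | tri< i<j i≢j _ = adjB-intro K i≢j (complete i j i<j a)
    ... | tri≈ _ refl _ = ⊥-elim (adj-irrefl G a)
    ... | tri> _ i≢j j<i = adj-sym K (adjB-intro K (≢-sym i≢j) (complete j i j<i (adj-sym G a)))
    backward : ∀ i j → Adj K i j → Adj G (lookup xs i) (lookup xs j)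
    backward i j a with adjB-elim K a
    ... | inj₁ p = sound i j (adj⇒≢ K a) p
    ... | inj₂ p = adj-sym G (sound j i (≢-sym (adj⇒≢ K a)) p)

  closed⇒all : ∀ {xs r} → (∀ u v → Reach G u v) → r ∈ xs → (∀ {x y} → x ∈ xs → Adj G x y → y ∈ xs) → ∀ v → v ∈ xs
  closed⇒all {xs} {r} con r∈ closed v = go r∈ (con r v)
    where
    go : ∀ {u} → u ∈ xs → Reach G u v → v ∈ xs
    go u∈ here = u∈
    go u∈ (step a p) = go (closed u∈ a) p

  claw-iso : (∀ u v → Reach G u v) → ∀ u → deg G u ≡ 3 → (∀ {v} → Adj G u v → deg G v ≡ 1) → Iso G K13
  claw-iso con u du leaf = build (nbrs G u) (nbrs-unique G u) (trans (sym (deg≡length-nbrs G u)) du) (∈-nbrs⁻ G) (∈-nbrs⁺ G)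
    where
    build : ∀ ws → Unique ws → length ws ≡ 3 → (∀ {w} → w ∈ ws → Adj G u w) → (∀ {w} → Adj G u w → w ∈ ws) → Iso G K13
    build ws@(a ∷ b ∷ c ∷ []) uws refl to from = iso-of-listing {u ∷ ws}
      (All.tabulate (adj⇒≢ G ∘ to) ∷ uws) (closed⇒all con (here refl) closed) (E K13) sound complete
      where
      closed : ∀ {x y} → x ∈ u ∷ ws → Adj G x y → y ∈ u ∷ ws
      closed (here refl) a = there (from a)
      closed (there q) a = here (deg-1⇒unique G (leaf (to q)) a (adj-sym G (to q)))
      sound : ∀ i j → i ≢ j → E K13 i j ≡ true → Adj G (lookup (u ∷ ws) i) (lookup (u ∷ ws) j)
      sound zero zero i≢j _ = ⊥-elim (i≢j refl)
      sound zero (suc j) _ _ = to (∈-lookup j)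
      complete : ∀ i j → i Fin.< j → Adj G (lookup (u ∷ ws) i) (lookup (u ∷ ws) j) → E K13 i j ≡ true
      complete zero j _ _ = refl
      complete (suc i) (suc j) _ a = ⊥-elim (adj⇒≢ G (to (∈-lookup j))
        (deg-1⇒unique G (leaf (to (∈-lookup i))) (adj-sym G (to (∈-lookup i))) a))

  deg-2⇒one-of : ∀ {v a b y} → deg G v ≤ 2 → a ≢ b → Adj G v a → Adj G v b → Adj G v y → (y ≡ a) ⊎ (y ≡ b)
  deg-2⇒one-of {v} {a} {b} {y} d a≢b va vb vy with y ≟ a | y ≟ b
  ... | yes p | _ = inj₁ p
  ... | no _ | yes q = inj₂ q
  ... | no y≢a | no y≢b = ⊥-elim (ℕₚ.<⇒≱ (ℕₚ.n<1+n 2) (ℕₚ.≤-trans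
    (length≤deg G {xs = y ∷ a ∷ b ∷ []} ((y≢a ∷ y≢b ∷ []) ∷ (a≢b ∷ []) ∷ [] ∷ [])
      (λ { (here refl) → vy ; (there (here refl)) → va ; (there (there (here refl))) → vb })) d))

  -- Growth happens at the head only, so the last vertex can be chosen beforehand: one of degree at
  -- most 1, if there is any.
  data Chain (p : V G) : List (V G) → Set where
    base : Chain p (p ∷ [])
    ext : ∀ {y x xs} → Adj G y x → y ∉ x ∷ xs → Chain p (x ∷ xs) → Chain p (y ∷ x ∷ xs)

  chain-unique : ∀ {p xs} → Chain p xs → Unique xs
  chain-unique base = [] ∷ []
  chain-unique (ext _ y∉ c) = All.tabulate (λ q → λ { refl → y∉ q }) ∷ chain-unique c

  chain-last : ∀ {p xs} → Chain p xs → ∀ i → suc (toℕ i) ≡ length xs → lookup xs i ≡ p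
  chain-last base zero _ = refl
  chain-last (ext _ _ c) (suc i) e = chain-last c i (ℕₚ.suc-injective e)

  chain-adj : ∀ {p xs} → Chain p xs → ∀ i j → toℕ j ≡ suc (toℕ i) → Adj G (lookup xs i) (lookup xs j)
  chain-adj base zero zero ()
  chain-adj (ext a _ c) zero (suc zero) _ = a
  chain-adj (ext _ _ c) (suc i) (suc j) e = chain-adj c i j (ℕₚ.suc-injective e)

  maximal-chain : ∀ fuel {p h xs} → Chain p (h ∷ xs) → n G ≤ fuel + length (h ∷ xs) →
    ∃ λ h → ∃ λ xs → Chain p (h ∷ xs) × (∀ {y} → Adj G h y → y ∈ h ∷ xs)
  maximal-chain fuel {p} {h} {xs} c l = grow fuel l (Finₚ.any? (λ y → adj? G h y ×-dec ¬? (Any.any? (y ≟_) (h ∷ xs))))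
    where
    grow : ∀ fuel → n G ≤ fuel + length (h ∷ xs) → Dec (∃ λ y → Adj G h y × ¬ (y ∈ h ∷ xs)) →
      ∃ λ h → ∃ λ xs → Chain p (h ∷ xs) × (∀ {y} → Adj G h y → y ∈ h ∷ xs)
    grow _ _ (no ¬y) = h , xs , c , inside
      where
      inside : ∀ {y} → Adj G h y → y ∈ h ∷ xs
      inside {y} a with Any.any? (y ≟_) (h ∷ xs)
      ... | yes y∈ = y∈
      ... | no y∉ = ⊥-elim (¬y (y , a , y∉))
    -- Without fuel the chain already has at least `n G` vertices, so a further one would have to
    -- repeat.
    grow zero l (yes (y , a , y∉)) = ⊥-elim (ℕₚ.<⇒≱ (ℕₚ.n<1+n _) (ℕₚ.≤-trans
      (unique-⊆-length (chain-unique (ext (adj-sym G a) y∉ c)) (λ _ → ∈-allFin _))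
      (ℕₚ.≤-trans (ℕₚ.≤-reflexive (length-tabulate id)) l)))
    grow (suc k) l (yes (y , a , y∉)) = maximal-chain k (ext (adj-sym G a) y∉ c)
      (subst (n G ≤_) (sym (ℕₚ.+-suc k (length (h ∷ xs)))) l)

  module MaximalChain (con : ∀ u v → Reach G u v) (deg≤2 : ∀ v → deg G v ≤ 2)
    {p h xs} (c : Chain p (h ∷ xs)) (maximal : ∀ {y} → Adj G h y → y ∈ h ∷ xs) where

    ys : List (V G)
    ys = h ∷ xs

    N : ℕ
    N = length ys

    at : Fin N → V G
    at = lookup ys

    previous : ∀ {i : Fin N} → 0 < toℕ i → ∃ λ (j : Fin N) → toℕ i ≡ suc (toℕ j)
    previous {suc i} _ = inject₁ i , cong suc (sym (Finₚ.toℕ-inject₁ i))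

    next : ∀ {i : Fin N} → suc (toℕ i) < N → ∃ λ (j : Fin N) → toℕ j ≡ suc (toℕ i)
    next l = Fin.fromℕ< l , Finₚ.toℕ-fromℕ< l

    at-injective : ∀ {i j} → at i ≡ at j → i ≡ j
    at-injective = lookup-injective (chain-unique c)

    -- The predecessor and the successor are two distinct neighbours, and degree at most 2 leaves no
    -- room for a third.
    inner : ∀ {i y} → 0 < toℕ i → suc (toℕ i) < N → Adj G (at i) y →
      ∃ λ j → y ≡ at j × ((toℕ i ≡ suc (toℕ j)) ⊎ (toℕ j ≡ suc (toℕ i)))
    inner {i} {y} pos l a =
      let j , ej = previous {i} pos
          k , ek = next {i} l
          j≢k = λ e → ℕₚ.<⇒≢ (subst (toℕ j <_) (sym (trans ek (cong suc ej))) (ℕₚ.n≤1+n _)) (cong toℕ (at-injective {j} {k} e))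
      in [ (λ e → j , e , inj₁ ej) , (λ e → k , e , inj₂ ek) ]′
           (deg-2⇒one-of (deg≤2 (at i)) j≢k (adj-sym G (chain-adj c j i ej)) (chain-adj c i k ek) a)

    -- Common to both outcomes: `cyclic` is `⊥` for a path and `⊤` for a cycle. Each adjacency is
    -- read off at its later vertex, so of the head it suffices to know that its neighbours lie in
    -- the chain.
    module Ends (cyclic : Set)
      (last : ∀ {i y} → 0 < toℕ i → suc (toℕ i) ≡ N → Adj G (at i) y →
        ∃ λ j → y ≡ at j × ((toℕ i ≡ suc (toℕ j)) ⊎ (toℕ j ≡ 0 × cyclic))) where

      all : ∀ v → v ∈ ys
      all = closed⇒all con (here refl) closed
        where
        closed-at : ∀ i {y} → Adj G (at i) y → y ∈ ys
        closed-at zero a = maximal a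
        closed-at i@(suc _) a with ℕₚ.m≤n⇒m<n∨m≡n (Finₚ.toℕ<n i)
        ... | inj₁ l = let j , e , _ = inner {i} (s≤s z≤n) l a in subst (_∈ ys) (sym e) (∈-lookup j)
        ... | inj₂ l = let j , e , _ = last {i} (s≤s z≤n) l a in subst (_∈ ys) (sym e) (∈-lookup j)
        closed : ∀ {x y} → x ∈ ys → Adj G x y → y ∈ ys
        closed x∈ a = closed-at (Any.index x∈) (subst (λ x → Adj G x _) (Anyₚ.lookup-index x∈) a)

      adjacent : ∀ i j → i Fin.< j → Adj G (at i) (at j) → (toℕ j ≡ suc (toℕ i)) ⊎ (toℕ i ≡ 0 × suc (toℕ j) ≡ N × cyclic)
      adjacent i j i<j a with ℕₚ.m≤n⇒m<n∨m≡n (Finₚ.toℕ<n j)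
      ... | inj₁ l = let k , e , o = inner {j} (ℕₚ.≤-<-trans z≤n i<j) l (adj-sym G a) in
        case-inner (at-injective {i} {k} e) o
        where
        case-inner : ∀ {k} → i ≡ k → (toℕ j ≡ suc (toℕ k)) ⊎ (toℕ k ≡ suc (toℕ j)) →
          (toℕ j ≡ suc (toℕ i)) ⊎ (toℕ i ≡ 0 × suc (toℕ j) ≡ N × cyclic)
        case-inner refl (inj₁ e) = inj₁ e
        case-inner refl (inj₂ e) = ⊥-elim (ℕₚ.<-asym i<j (ℕₚ.≤-reflexive (sym e)))
      ... | inj₂ l = let k , e , o = last {j} (ℕₚ.≤-<-trans z≤n i<j) l (adj-sym G a) in
        case-last (at-injective {i} {k} e) o
        where
        case-last : ∀ {k} → i ≡ k → (toℕ j ≡ suc (toℕ k)) ⊎ (toℕ k ≡ 0 × cyclic) →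
          (toℕ j ≡ suc (toℕ i)) ⊎ (toℕ i ≡ 0 × suc (toℕ j) ≡ N × cyclic)
        case-last refl (inj₁ e) = inj₁ e
        case-last refl (inj₂ (z , y)) = inj₂ (z , l , y)

    path : deg G p ≤ 1 → IsPath G
    path dp = N , iso-of-listing (chain-unique c) all (E (pathGraph N))
      (λ i j _ e → chain-adj c i j (≡ᵇ-sound (toℕ j) _ e)) complete
      where
      last-nbrs : ∀ {i y} → 0 < toℕ i → suc (toℕ i) ≡ N → Adj G (at i) y →
        ∃ λ j → y ≡ at j × ((toℕ i ≡ suc (toℕ j)) ⊎ (toℕ j ≡ 0 × ⊥))
      last-nbrs {i} {y} pos l ay =
        let j , ej = previous {i} pos
            aj = adj-sym G (chain-adj c j i ej)
            di = ℕₚ.≤-antisym (subst (λ v → deg G v ≤ 1) (sym (chain-last c i l)) dp) (adj⇒0<deg G aj)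
        in j , deg-1⇒unique G di ay aj , inj₁ ej
      open Ends ⊥ last-nbrs
      complete : ∀ i j → i Fin.< j → Adj G (at i) (at j) → E (pathGraph N) i j ≡ true
      complete i j i<j a with adjacent i j i<j a
      ... | inj₁ e = ≡ᵇ-complete e

    cycle : (∀ v → 2 ≤ deg G v) → IsCycle G
    cycle 2≤deg = close second-neighbour
      where
      second-neighbour : ∃ λ j → 2 ≤ toℕ j × Adj G h (at j)
      second-neighbour = pick (nbrs G h) (nbrs-unique G h) (subst (2 ≤_) (deg≡length-nbrs G h) (2≤deg h)) (∈-nbrs⁻ G)
        where
        position : ∀ {y} → Adj G h y → ∃ λ j → y ≡ at j × 1 ≤ toℕ j
        position {y} a with maximal a
        ... | here refl = ⊥-elim (adj-irrefl G a)
        ... | there q = suc (Any.index q) , Anyₚ.lookup-index q , s≤s z≤n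
        far : ∀ {y} → Adj G h y → (∃ λ j → y ≡ at j × 1 ≤ toℕ j) → (∃ λ j → 2 ≤ toℕ j × Adj G h (at j)) ⊎ (∃ λ j → y ≡ at j × toℕ j ≡ 1)
        far a (j , refl , l) with ℕₚ.m≤n⇒m<n∨m≡n l
        ... | inj₁ l′ = inj₁ (j , l′ , a)
        ... | inj₂ e = inj₂ (j , refl , sym e)
        pick : ∀ ws → Unique ws → 2 ≤ length ws → (∀ {w} → w ∈ ws → Adj G h w) → ∃ λ j → 2 ≤ toℕ j × Adj G h (at j)
        pick (_ ∷ []) _ (s≤s ()) _
        pick (a ∷ b ∷ _) ((a≢b ∷ _) ∷ _) _ to
          with far (to (here refl)) (position (to (here refl))) | far (to (there (here refl))) (position (to (there (here refl))))
        ... | inj₁ r | _ = r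
        ... | inj₂ _ | inj₁ r = r
        ... | inj₂ (j , ea , ej) | inj₂ (k , eb , ek) =
          ⊥-elim (a≢b (trans ea (trans (cong at (Finₚ.toℕ-injective (trans ej (sym ek)))) (sym eb))))
      close : (∃ λ j → 2 ≤ toℕ j × Adj G h (at j)) → IsCycle G
      close (k , 2≤k , hk) = N , ℕₚ.≤-trans (s≤s 2≤k) (Finₚ.toℕ<n k) ,
        iso-of-listing (chain-unique c) all (E (cycleGraph N)) sound complete
        where
        -- At an inner position `k`, the adjacent head would have to be the predecessor, forcing `k`
        -- to be 1 against `2 ≤ toℕ k`.
        k-last : suc (toℕ k) ≡ N
        k-last with ℕₚ.m≤n⇒m<n∨m≡n (Finₚ.toℕ<n k)
        ... | inj₂ e = e
        ... | inj₁ l = let j , e , o = inner {k} (ℕₚ.≤-trans (s≤s z≤n) 2≤k) l (adj-sym G hk) in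
          ⊥-elim (absurd (at-injective {zero} {j} e) o)
          where
          absurd : ∀ {j} → zero ≡ j → (toℕ k ≡ suc (toℕ j)) ⊎ (toℕ j ≡ suc (toℕ k)) → ⊥
          absurd refl (inj₁ e) = ℕₚ.<⇒≢ 2≤k (sym e)
          absurd refl (inj₂ ())
        last-nbrs : ∀ {i y} → 0 < toℕ i → suc (toℕ i) ≡ N → Adj G (at i) y →
          ∃ λ j → y ≡ at j × ((toℕ i ≡ suc (toℕ j)) ⊎ (toℕ j ≡ 0 × ⊤))
        last-nbrs {i} pos l a with Finₚ.toℕ-injective {i = i} {j = k} (ℕₚ.suc-injective (trans l (sym k-last)))
        ... | refl =
          let j , ej = previous {k} pos
              j≢0 = λ e → ℕₚ.<⇒≢ 2≤k (sym (trans ej (cong (suc ∘ toℕ) (at-injective {j} {zero} e))))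
          in [ (λ e → j , e , inj₁ ej) , (λ e → zero , e , inj₂ (refl , tt)) ]′
               (deg-2⇒one-of (deg≤2 (at k)) j≢0 (adj-sym G (chain-adj c j k ej)) (adj-sym G hk) a)
        open Ends ⊤ last-nbrs
        sound : ∀ i j → i ≢ j → E (cycleGraph N) i j ≡ true → Adj G (at i) (at j)
        sound i j _ e with ∨-split {toℕ j ℕ.≡ᵇ suc (toℕ i)} e
        ... | inj₁ p = chain-adj c i j (≡ᵇ-sound (toℕ j) _ p)
        ... | inj₂ q = let z , w = ∧-split {toℕ i ℕ.≡ᵇ 0} q in
          subst₂ (λ i j → Adj G (at i) (at j))
            (Finₚ.toℕ-injective {i = zero} {j = i} (sym (≡ᵇ-sound (toℕ i) 0 z)))
            (Finₚ.toℕ-injective {i = k} {j = j} (trans (ℕₚ.suc-injective k-last) (sym (≡ᵇ-sound (toℕ j) _ w)))) hk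
        complete : ∀ i j → i Fin.< j → Adj G (at i) (at j) → E (cycleGraph N) i j ≡ true
        complete i j i<j a with adjacent i j i<j a
        ... | inj₁ e = ∨-left (≡ᵇ-complete e)
        ... | inj₂ (z , l , _) = ∨-right (toℕ j ℕ.≡ᵇ suc (toℕ i))
          (cong₂ _∧_ (≡ᵇ-complete z) (≡ᵇ-complete (ℕₚ.suc-injective l)))

  -- Degree sums along edges of graphs in the family

  HeavyEdge : Set
  HeavyEdge = ∃ λ u → ∃ λ v → Adj G u v × 3 ≤ deg G u × 5 ≤ deg G u + deg G v

  heavyEdge? : Dec HeavyEdge
  heavyEdge? = Finₚ.any? (λ u → Finₚ.any? (λ v → adj? G u v ×-dec 3 ℕ.≤? deg G u ×-dec 5 ℕ.≤? deg G u + deg G v))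

  max-deg-2⇒path-or-cycle : 0 < n G → (∀ u v → Reach G u v) → (∀ v → deg G v ≤ 2) → IsPath G ⊎ IsCycle G
  max-deg-2⇒path-or-cycle pos con deg≤2 = split (Finₚ.any? (λ p → deg G p ℕ.≤? 1))
    where
    chain-from : ∀ p → ∃ λ h → ∃ λ xs → Chain p (h ∷ xs) × (∀ {y} → Adj G h y → y ∈ h ∷ xs)
    chain-from p = maximal-chain (n G) base (ℕₚ.m≤m+n (n G) 1)
    split : Dec (∃ λ p → deg G p ≤ 1) → IsPath G ⊎ IsCycle G
    split (yes (p , dp)) = let h , xs , c , max = chain-from p in inj₁ (MaximalChain.path con deg≤2 c max dp)
    split (no ¬p) = let h , xs , c , max = chain-from (Fin.fromℕ< pos) in
      inj₂ (MaximalChain.cycle con deg≤2 c max (λ v → ℕₚ.≰⇒> (λ d → ¬p (v , d))))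

  -- Otherwise either all degrees are at most 2, which leaves paths and cycles, or a vertex of
  -- degree at least 3 has degree sum at most 4 with every neighbour; it then has degree 3 and only
  -- leaves around it, a claw.
  family⇒heavyEdge : InFamily G → HeavyEdge
  family⇒heavyEdge ((pos , con) , ¬path , ¬cycle , ¬claw) with heavyEdge?
  ... | yes h = h
  ... | no ¬h = ⊥-elim (split (Finₚ.any? (λ u → 3 ℕ.≤? deg G u)))
    where
    split : Dec (∃ λ u → 3 ≤ deg G u) → ⊥
    split (no ¬u) = [ ¬path , ¬cycle ]′ (max-deg-2⇒path-or-cycle pos con (λ v → ℕₚ.≤-pred (ℕₚ.≰⇒> (λ d → ¬u (v , d)))))
    split (yes (u , du)) = ¬claw (claw-iso con u deg-3 leaf)
      where
      sum≤4 : ∀ {v} → Adj G u v → deg G u + deg G v ≤ 4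
      sum≤4 a = ℕₚ.≤-pred (ℕₚ.≰⇒> (λ l → ¬h (u , _ , a , du , l)))
      some-nbr : ∃ λ v → Adj G u v
      some-nbr = let e , i = 0<deg⇒incident G (ℕₚ.≤-trans (s≤s z≤n) du)
                     v , j = incident⇒joins G i in v , joins⇒adj G j
      deg-3 : deg G u ≡ 3
      deg-3 = let v , a = some-nbr in ℕₚ.≤-antisym
        (ℕₚ.+-cancelʳ-≤ 1 _ _ (ℕₚ.≤-trans (ℕₚ.+-monoʳ-≤ (deg G u) (adj⇒0<deg G (adj-sym G a))) (sum≤4 a))) du
      leaf : ∀ {v} → Adj G u v → deg G v ≡ 1
      leaf {v} a = ℕₚ.≤-antisym (ℕₚ.+-cancelˡ-≤ 3 _ _ (ℕₚ.≤-trans (ℕₚ.+-monoˡ-≤ (deg G v) du) (sum≤4 a)))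
        (adj⇒0<deg G (adj-sym G a))

-- The four cases of the bound

theorem1p4 : (G : Graph) → InFamily G → (s t : ℕ) →
    (minDeg G ≤ 2 → s ≡ 0 → t ≡ 0 →
    ∀ l → IsEll G l → IndexAtMost s t G l)
    × (minDeg G ≤ 2 → 1 ≤ s + t →
    ∀ d → IsDtilde G d → IndexAtMost s t G (d + 1 + ⌈log₂ (s + t + 1) ⌉))
    × (3 ≤ minDeg G → minDeg G ≤ s + t + 2 →
    ∀ k → IsCeilLog2Frac (s + t + 1) (minDeg G ∸ 2) k → IndexAtMost s t G (1 + k))
    × (3 ≤ minDeg G → s + t + 2 < minDeg G → IndexAtMost s t G 1)
theorem1p4 G fam@((_ , con) , _) s t = eulerian , small , medium , large
  where
  heavyEdge : HeavyEdge G
  heavyEdge = family⇒heavyEdge G fam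

  eulerian : minDeg G ≤ 2 → s ≡ 0 → t ≡ 0 → ∀ l → IsEll G l → IndexAtMost s t G l
  -- ℓ(G) is positive because a single edge is a proper divalent path.
  eulerian _ refl refl zero ell = ⊥-elim (ℕₚ.<⇒≱ (ℕₚ.n<1+n 0) (adj⇒1≤ell G ell (proj₁ (proj₂ (proj₂ heavyEdge)))))
  eulerian _ refl refl (suc l) ell = suc l , ℕₚ.≤-refl , branched⇒supereulerian l G (ell⇒branched G ell con heavyEdge)

  small : minDeg G ≤ 2 → 1 ≤ s + t → ∀ d → IsDtilde G d → IndexAtMost s t G (d + 1 + ⌈log₂ (s + t + 1) ⌉)
  -- Since the minimum degree of `L^ d G` is at least `3 = 2 + 1`, the iteration starts there with
  -- `b = 1` and needs only `s + t + 1 ≤ 2 ^ c`.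
  small _ _ d (3≤δ , _) = suc c + d , ℕₚ.≤-reflexive (trans (ℕₚ.+-comm (suc c) d) (sym (ℕₚ.+-assoc d 1 c))) ,
    supereulerian-resp-≡ (L^ (suc c) (L^ d G)) (L^ (suc c + d) G) (L^-+ (suc c) d G)
      (iterate⇒supereulerian (L^ d G) s t 1 c (L^-connected d G con) 3≤δ
        (subst (s + t + 1 ≤_) (sym (ℕₚ.*-identityˡ (2 ^ c))) (n≤2^⌈log₂n⌉ (s + t + 1))))
    where
    c = ⌈log₂ (s + t + 1) ⌉

  medium : 3 ≤ minDeg G → minDeg G ≤ s + t + 2 → ∀ k → IsCeilLog2Frac (s + t + 1) (minDeg G ∸ 2) k → IndexAtMost s t G (1 + k)
  medium 3≤δ _ k (bound , _) = suc k , ℕₚ.≤-refl , iterate⇒supereulerian G s t (minDeg G ∸ 2) k con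
    (ℕₚ.≤-reflexive (ℕₚ.m+[n∸m]≡n (ℕₚ.≤-trans (ℕₚ.n≤1+n 2) 3≤δ))) bound

  large : 3 ≤ minDeg G → s + t + 2 < minDeg G → IndexAtMost s t G 1
  large _ l = 1 , ℕₚ.≤-refl , large-minDeg⇒supereulerian G s t con (subst (_≤ minDeg G) (sym (ℕₚ.+-suc (s + t) 2)) l)
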